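{- Let $N\ge2$, let $$\mathcal Q_N=\{\pi_{a,b}(X)=aX^2+bX\in\mathbb Z_N[X]:\ \pi_{a,b}\text{ permutes }\mathbb Z_N,\ a\not\equiv 0\pmod N\},$$ and let $$\mathcal Q^{\rm irr}_N=\{\pi_{a,b}\in\mathcal Q_N:\ \gcd(N,2a)<N\}.$$ Then the following are equivalent: (1) $\mathcal Q^{\rm irr}_N\neq\varnothing$ and, for every $\pi\in\mathcal Q^{\rm irr}_N$, every $u\in\mathbb Z$ with $\gcd(u,N)=1$ and every $q\in\mathbb Z$, the sequence $k\mapsto z_{u,q,N}(\pi(k))$ on $\mathbb Z_N$ is not equivalent to any Zadoff--Chu sequence; (2) $9\nmid N$ and ($8\mid N$ or $p^2\mid N$ for some odd prime $p$).
   Context: Write $\mathbb Z_N=\mathbb Z/N\mathbb Z$, $\zeta_N=\exp(-\pi\sqrt{ -1}/N)$, $W_N=\zeta_N^2=\exp(-2\pi\sqrt{ -1}/N)$, and $\varepsilon_N=N\bmod 2\in\{0,1\}$. For $u\in\mathbb Z$ with $\gcd(u,N)=1$ and $q\in\mathbb Z$, the length-$N$ Zadoff--Chu sequence is $z_{u,q,N}(t)=\zeta_N^{u(t+\varepsilon_N+2q)t}$; this depends only on $t$ modulo $N$, so it is a function on $\mathbb Z_N$. The quantity $\gcd(N,2a)$ is computed with any integer representative of $a\in\mathbb Z_N$. Equivalence is under the five operations on sequences $s:\mathbb Z_N\to\mathbb C$: $s(k)\mapsto c\,s(k)$ with $|c|=1$; $s(k)\mapsto s(k+d)$ with $d\in\mathbb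 Z_N$; $s(k)\mapsto s(rk)$ with $r\in\mathbb Z_N^\times$; $s(k)\mapsto W_N^{\lambda k}s(k)$ with $\lambda\in\mathbb Z_N$; $s(k)\mapsto\overline{s(k)}$. Equivalently, a sequence $s$ on $\mathbb Z_N$ is equivalent to a Zadoff--Chu sequence if there exist $\sigma\in\{\pm1\}$, $r\in\mathbb Z_N^\times$, $d,\lambda\in\mathbb Z_N$, $u'$ coprime to $N$, $q'$, and a unimodular constant $c$ such that $s(k)=c\,W_N^{\lambda k}\,\zeta_N^{\sigma u'(rk+d+\varepsilon_N+2q')(rk+d)}$ for all $k\in\mathbb Z_N$. -}

module Defs where

open import Level using (Level; suc; _⊔_)
open import Algebra.Apartness.Bundles using (HeytingField; HeytingCommutativeRing)
open import Algebra.Bundles using (CommutativeRing)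
open import Algebra.Bundles.Raw using (RawMonoid)
import Algebra.Definitions.RawMonoid as RawMonoidDefinitions
open import Data.Fin.Base using (Fin; toℕ)
open import Data.Integer.Base as ℤ using (ℤ; +_; -[1+_])
import Data.Integer.GCD as ℤ
open import Data.Nat.Base as ℕ using (ℕ; zero; NonZero)
open import Data.Nat.DivMod using (_mod_; _%_)
import Data.Nat.GCD as ℕ
open import Data.Product.Base using (_×_; _,_; ∃-syntax; proj₁; proj₂)
open import Data.Sum.Base using (_⊎_; inj₂)
open import Function.Bundles using (_⇔_; Equivalence)
open import Function.Definitions using (Bijective)
open import Relation.Binary.Construct.Closure.Equivalence using (EqClosure)
open import Relation.Binary.Core using (Rel)
open import Relation.Binary.PropositionalEquality.Core using (_≡_; _≢_)
open import Relation.Binary.Structures using (IsStrictPartialOrder)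

private variable
  c ℓ₁ ℓ₂ ℓ₃ : Level

-- The real numbers, specified up to isomorphism as a Cauchy-complete
-- Archimedean ordered field.

record RealNumbers c ℓ₁ ℓ₂ ℓ₃ : Set (suc (c ⊔ ℓ₁ ⊔ ℓ₂ ⊔ ℓ₃)) where
  infix 4 _<_
  field
    heytingField : HeytingField c ℓ₁ ℓ₂

  open HeytingField heytingField public

  open RawMonoidDefinitions
    (CommutativeRing.+-rawMonoid
      (HeytingCommutativeRing.commutativeRing heytingCommutativeRing))
    public using () renaming (_×_ to _·_)

  fromℕ : ℕ → Carrier
  fromℕ n = n · 1#

  field
    _<_                  : Rel Carrier ℓ₃
    isStrictPartialOrder : IsStrictPartialOrder _≈_ _<_
    #⇔<⊎>                : ∀ {x y} → x # y ⇔ (x < y ⊎ y < x)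
    +-monoˡ-<            : ∀ {x y} z → x < y → x + z < y + z
    *-pos                : ∀ {x y} → 0# < x → 0# < y → 0# < x * y
    0<1                  : 0# < 1#
    archimedean          : ∀ x → ∃[ n ] x < fromℕ n

  open IsStrictPartialOrder isStrictPartialOrder public using ()
    renaming ( irrefl to <-irrefl; trans to <-trans
             ; <-resp-≈ to <-resp-≈; <-respˡ-≈ to <-respˡ-≈; <-respʳ-≈ to <-respʳ-≈ )

  -- ∣ x - y ∣ < ε
  Within : Carrier → Carrier → Carrier → Set ℓ₃
  Within ε x y = x - y < ε × y - x < ε

  Cauchy : (ℕ → Carrier) → Set (c ⊔ ℓ₃)
  Cauchy f = ∀ ε → 0# < ε →
    ∃[ n ] (∀ i j → n ℕ.≤ i → n ℕ.≤ j → Within ε (f i) (f j))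

  _ConvergesTo_ : (ℕ → Carrier) → Carrier → Set (c ⊔ ℓ₃)
  f ConvergesTo x = ∀ ε → 0# < ε →
    ∃[ n ] (∀ i → n ℕ.≤ i → Within ε (f i) x)

  field
    complete : ∀ f → Cauchy f → ∃[ x ] f ConvergesTo x

  0<fromℕ : ∀ n → 0# < fromℕ (ℕ.suc n)
  0<fromℕ zero      = <-respʳ-≈ (sym (+-identityʳ 1#)) 0<1
  0<fromℕ (ℕ.suc n) = <-trans (0<fromℕ n)
    (<-respˡ-≈ (+-identityˡ _) (+-monoˡ-< (fromℕ (ℕ.suc n)) 0<1))

  fromℕ#0 : ∀ n .{{_ : NonZero n}} → fromℕ n # 0#
  fromℕ#0 (ℕ.suc n) = Equivalence.from #⇔<⊎> (inj₂ (0<fromℕ n))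

  infixl 7 _/_
  _/_ : Carrier → (n : ℕ) .{{_ : NonZero n}} → Carrier
  x / n = x * proj₁ (#⇒invertible (fromℕ#0 n))

-- Apostol's axioms for π and the circular functions (Calculus I, §2.5), which
-- determine π, cos and sin uniquely on ℝ.  The last three fields are
-- 0 < cos x < sin x / x < 1 / cos x with denominators cleared.

record CircularFunctions (R : RealNumbers c ℓ₁ ℓ₂ ℓ₃) : Set (c ⊔ ℓ₁ ⊔ ℓ₃) where
  open RealNumbers R
  field
    π        : Carrier
    cos sin  : Carrier → Carrier
    cos-cong : ∀ {x y} → x ≈ y → cos x ≈ cos y
    sin-cong : ∀ {x y} → x ≈ y → sin x ≈ sin y
    0<π      : 0# < π
    cos-0    : cos 0# ≈ 1#
    sin-π/2  : sin (π / 2) ≈ 1#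
    cos-π    : cos π ≈ - 1#
    cos-sub  : ∀ x y → cos (y - x) ≈ cos y * cos x + sin y * sin x
    0<cos    : ∀ {x} → 0# < x → x < π / 2 → 0# < cos x
    xcos<sin : ∀ {x} → 0# < x → x < π / 2 → x * cos x < sin x
    sincos<x : ∀ {x} → 0# < x → x < π / 2 → sin x * cos x < x

module ComplexNumbers (R : RealNumbers c ℓ₁ ℓ₂ ℓ₃) where
  private module ℝ = RealNumbers R

  infix  4 _≈_
  infixl 7 _*_
  infixr 8 _^_

  record ℂ : Set c where
    constructor _+i_
    field
      re im : ℝ.Carrier
  open ℂ public

  _≈_ : Rel ℂ ℓ₁
  z ≈ w = re z ℝ.≈ re w × im z ℝ.≈ im w

  1ℂ : ℂ
  1ℂ = ℝ.1# +i ℝ.0#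

  _*_ : ℂ → ℂ → ℂ
  (a +i b) * (x +i y) = (a ℝ.* x ℝ.- b ℝ.* y) +i (a ℝ.* y ℝ.+ b ℝ.* x)

  conj : ℂ → ℂ
  conj (a +i b) = a +i (ℝ.- b)

  -- ∣ z ∣ = 1, stated as ∣ z ∣² = 1
  Unimodular : ℂ → Set ℓ₁
  Unimodular z = re z ℝ.* re z ℝ.+ im z ℝ.* im z ℝ.≈ ℝ.1#

  *-rawMonoid : RawMonoid c ℓ₁
  *-rawMonoid = record { Carrier = ℂ ; _≈_ = _≈_ ; _∙_ = _*_ ; ε = 1ℂ }

  _^_ : ℂ → ℕ → ℂ
  z ^ n = n Power.× z
    where module Power = RawMonoidDefinitions *-rawMonoid

  -- Integer powers of a unimodular number, whose inverse is its conjugate;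
  -- not meaningful for other z.
  _^ᶻ_ : ℂ → ℤ → ℂ
  z ^ᶻ (+ n)    = z ^ n
  z ^ᶻ -[1+ n ] = conj z ^ ℕ.suc n

-- ℤ_N is represented by Fin N, i.e. by least non-negative residues.

module Residues (N : ℕ) .{{_ : NonZero N}} where

  ℤ/N : Set
  ℤ/N = Fin N

  infixl 6 _⊕_
  infixl 7 _⊗_

  _⊕_ _⊗_ : ℤ/N → ℤ/N → ℤ/N
  a ⊕ b = (toℕ a ℕ.+ toℕ b) mod N
  a ⊗ b = (toℕ a ℕ.* toℕ b) mod N

  IsUnit : ℤ/N → Set
  IsUnit r = ∃[ s ] r ⊗ s ≡ 1 mod N

  -- The coefficient pair (a , b) stands for the polynomial aX² + bX.
  poly : ℤ/N → ℤ/N → ℤ/N → ℤ/N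
  poly a b x = a ⊗ (x ⊗ x) ⊕ b ⊗ x

  𝒬 : ℤ/N → ℤ/N → Set
  𝒬 a b = Bijective _≡_ _≡_ (poly a b) × a ≢ 0 mod N

  𝒬-irr : ℤ/N → ℤ/N → Set
  𝒬-irr a b = 𝒬 a b × ℕ.gcd N (2 ℕ.* toℕ a) ℕ.< N

module Sequences {R : RealNumbers c ℓ₁ ℓ₂ ℓ₃} (C : CircularFunctions R)
                 (N : ℕ) .{{_ : NonZero N}} where
  private module ℝ = RealNumbers R
  open CircularFunctions C
  open ComplexNumbers R
  open Residues N

  -- ζ = exp (- π √-1 / N), by Euler's formula
  ζ : ℂ
  ζ = cos (ℝ.- (π ℝ./ N)) +i sin (ℝ.- (π ℝ./ N))

  W : ℂ
  W = ζ ^ 2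

  Sequence : Set c
  Sequence = ℤ/N → ℂ

  -- ζ ^ (u (t + ε + 2q) t) with ε = N mod 2 depends only on t modulo N, so it is
  -- evaluated at the least residue t.
  zadoffChu : (u q : ℤ) → Sequence
  zadoffChu u q k = ζ ^ᶻ (u ℤ.* (t ℤ.+ + (N % 2) ℤ.+ + 2 ℤ.* q) ℤ.* t)
    where t = + toℕ k

  data Operation (s t : Sequence) : Set (c ⊔ ℓ₁) where
    scale     : ∀ z → Unimodular z → (∀ k → t k ≈ z * s k) → Operation s t
    shift     : ∀ d → (∀ k → t k ≈ s (k ⊕ d)) → Operation s t
    decimate  : ∀ r → IsUnit r → (∀ k → t k ≈ s (r ⊗ k)) → Operation s t
    modulate  : ∀ (l : ℤ/N) → (∀ k → t k ≈ W ^ (toℕ l ℕ.* toℕ k) * s k) →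
                Operation s t
    conjugate : (∀ k → t k ≈ conj (s k)) → Operation s t

  Equivalent : Rel Sequence (c ⊔ ℓ₁)
  Equivalent = EqClosure Operation

  EquivalentToZadoffChu : Sequence → Set (c ⊔ ℓ₁)
  EquivalentToZadoffChu s =
    ∃[ u ] ∃[ q ] ℤ.gcd u (+ N) ≡ + 1 × Equivalent s (zadoffChu u q)

{-# OPTIONS --safe #-}
module Submission where

-- Call a sequence on ℤ_N a quadratic phase if its third multiplicative difference
-- is 1 along every arithmetic progression.  Zadoff–Chu sequences are quadratic
-- phases and the five operations preserve this property in both directions.  For
-- π = a X² + b X the third difference of z ∘ π at - 1 is W ^ (6 u a (a + b)), so an
-- equivalence of z ∘ π with a Zadoff–Chu sequence forces N ∣ 6 u a (a + b).  A
-- permutation polynomial is injective modulo every divisor of N, whence a + b is a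
-- unit and odd primes dividing N divide a; if 9 ∤ N this improves N ∣ 6 a to N ∣ 2 a,
-- that is, gcd(N, 2 a) = N.  If 9 ∣ N, then π = (N / 3) X² + X only modulates a
-- suitable z, because k³ ≡ k mod 3.

open import Defs
open import Level using (Level)
open import Algebra.Apartness.Bundles using (HeytingCommutativeRing)
import Algebra.Apartness.Properties.HeytingCommutativeRing as HeytingProperties
open import Algebra.Bundles using (CommutativeMonoid; CommutativeRing)
import Algebra.Properties.CommutativeSemigroup as CommutativeSemigroupProperties
import Algebra.Properties.Monoid.Mult as MonoidMult
import Algebra.Properties.Ring as RingProperties
import Algebra.Properties.Semiring.Mult as SemiringMult
import Algebra.Solver.Ring.NaturalCoefficients.Default as SemiringSolver
open import Data.Fin.Base as Fin using (Fin; toℕ; fromℕ<)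
import Data.Fin.Properties as Fin
open import Data.Integer.Base as ℤ using (ℤ; +_; -[1+_]; _⊖_)
open import Data.Integer.DivMod using (_%ℕ_; _/ℕ_; n%ℕd<d; a≡a%ℕn+[a/ℕn]*n)
open import Data.Integer.Divisibility.Signed
  using (divides; ∣ᵤ⇒∣; ∣⇒∣ᵤ; ∣m∣n⇒∣m+n; ∣m∣n⇒∣m-n; ∣m⇒∣-m; ∣n⇒∣m*n; ∣m⇒∣m*n)
  renaming (_∣_ to _∣ᶻ_; ∣-trans to ∣ᶻ-trans)
open import Data.Integer.GCD using (gcd; gcd-zeroˡ)
import Data.Integer.Properties as ℤ
open import Data.Integer.Tactic.RingSolver using (solve-∀)
open import Data.List.Base using ([]; _∷_)
open import Data.List.Relation.Unary.All using ([]; _∷_)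
open import Data.Nat.Base as ℕ using (ℕ; zero; suc; NonZero)
open import Data.Nat.Coprimality as Coprime using (Coprime; coprime-divisor; gcd≡1⇒coprime)
open import Data.Nat.Divisibility
  using (_∣_; _∤_; _∣?_; ∣-trans; ∣-refl; ∣-antisym; ∣⇒≤; ∣1⇒≡1; 0∣⇒≡0; >⇒∤; quotient>1;
         m∣m*n; n∣m*n; m∣n⇒n≡quotient*m; *-pres-∣; *-monoˡ-∣; *-monoʳ-∣; *-cancelˡ-∣;
         *-cancelʳ-∣; ∣m+n∣m⇒∣n)
  renaming (∣n⇒∣m*n to ∣ℕn⇒∣m*n; divides to dividesℕ; ∣m∣n⇒∣m+n to ∣ℕm∣n⇒∣m+n)
open import Data.Nat.DivMod using (_mod_; m≡m%n+[m/n]*n)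
import Data.Nat.GCD as ℕ
open import Data.Nat.GCD using (module Bézout)
open import Data.Nat.Primality using (Prime; prime?; prime[2]; prime⇒irreducible; prime⇒nonTrivial)
open import Data.Nat.Primality.Factorisation using (factorise)
import Data.Nat.Properties as ℕ
open import Data.Product.Base using (_×_; _,_; proj₁; proj₂; ∃-syntax)
open import Data.Sum.Base using (_⊎_; inj₁; inj₂)
open import Function.Base using (_∘_)
open import Function.Bundles using (_⇔_; mk⇔; Equivalence)
open import Function.Consequences.Propositional using (strictlySurjective⇒surjective)
open import Function.Definitions using (Injective; StrictlySurjective; Bijective)
open import Function.Properties.Equivalence using (⇔-isEquivalence)
import Relation.Binary.Construct.Closure.Equivalence as EqClosure
import Relation.Binary.Construct.Closure.ReflexiveTransitive as Star
open import Relation.Binary.Construct.Closure.Symmetric using (bwd)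
open import Relation.Binary.Definitions using (tri<; tri≈; tri>)
import Relation.Binary.PropositionalEquality as ≡
open import Relation.Binary.PropositionalEquality.Core using (_≡_; _≢_)
import Relation.Binary.Reasoning.Setoid as SetoidReasoning
open import Relation.Nullary.Decidable using (yes; no; from-yes; from-no)
open import Relation.Nullary.Negation.Core using (¬_; contradiction)

-- Everything rests on the exact order of `W`. A trivial third difference is an equation between
-- powers of `ζ`, and it becomes a divisibility by N only because `W` ^ r is not 1 for 0 < r < N.
-- Since cosine and sine are given by axioms alone, this is derived from the positivity of sin (r π
-- / N) for these r.
--
-- Positions matter modulo N, but exponents of `ζ` matter modulo 2 N. Phases are therefore lifted to
-- polynomial functions on ℤ, where identities can be checked formally; the parity term ε is what
-- makes the lifted phase periodic.
--
-- The base point - 1 is chosen for its last factor. With step 1 from x, the third difference of π²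
-- is 12 a (a (2 x + 3) + b). At x = - 1 the bracket is a + b = π(1) - π(0), which is a unit because
-- π separates 0 from 1 modulo every divisor d > 1 of N.

private variable
  c ℓ₁ ℓ₂ ℓ₃ : Level

-- Arithmetic and signs in the ordered field of real numbers.

module RealProperties (R : RealNumbers c ℓ₁ ℓ₂ ℓ₃) where
  open RealNumbers R

  commutativeRing : CommutativeRing c ℓ₁
  commutativeRing = HeytingCommutativeRing.commutativeRing heytingCommutativeRing

  open RingProperties (CommutativeRing.ring commutativeRing) public
  open SemiringMult (CommutativeRing.semiring commutativeRing) public
    using (×-homo-+; ×-assoc-*; ×-congʳ; ×-congˡ; ×-assocˡ; ×-comm-*)
  open HeytingProperties heytingCommutativeRing using (x-0≈x; invertibleˡ⇒#)
  open SetoidReasoning (CommutativeRing.setoid commutativeRing)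

  -- By tightness it suffices to refute `x # 0#`: an inverse y of x would give x = x x y = 0.
  x*x≈0⇒x≈0 : ∀ {x} → x * x ≈ 0# → x ≈ 0#
  x*x≈0⇒x≈0 {x} x²≈0 = proj₁ (tight x 0#) λ x#0 →
    let y , _ , x-0*y≈1 = #⇒invertible x#0 in
    contradiction x#0 (proj₂ (tight x 0#) (begin
      x                    ≈⟨ *-identityʳ x ⟨
      x * 1#               ≈⟨ *-congˡ x-0*y≈1 ⟨
      x * ((x - 0#) * y)   ≈⟨ *-congˡ (*-congʳ (x-0≈x x)) ⟩
      x * (x * y)          ≈⟨ *-assoc x x y ⟨
      x * x * y            ≈⟨ *-congʳ x²≈0 ⟩
      0# * y               ≈⟨ zeroˡ y ⟩
      0#                   ∎))

  +-pos : ∀ {x y} → 0# < x → 0# < y → 0# < x + y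
  +-pos {x} {y} 0<x 0<y = <-trans 0<y (<-respˡ-≈ (+-identityˡ y) (+-monoˡ-< y 0<x))

  ·-pos : ∀ {x} n → 0# < x → 0# < suc n · x
  ·-pos zero    0<x = <-respʳ-≈ (sym (+-identityʳ _)) 0<x
  ·-pos (suc n) 0<x = +-pos 0<x (·-pos n 0<x)

  ·-monoˡ-< : ∀ {x m n} → 0# < x → m ℕ.< n → m · x < n · x
  ·-monoˡ-< {x} {m} {n} 0<x m<n with d , ≡.refl ← ℕ.m≤n⇒∃[o]m+o≡n m<n =
    <-respˡ-≈ (+-identityˡ (m · x)) (<-respʳ-≈ lemma (+-monoˡ-< (m · x) (·-pos d 0<x)))
    where
    lemma : suc d · x + m · x ≈ (suc m ℕ.+ d) · x
    lemma = begin
      suc d · x + m · x   ≈⟨ ×-homo-+ x (suc d) m ⟨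
      (suc d ℕ.+ m) · x   ≈⟨ ×-congˡ (≡.cong suc (ℕ.+-comm d m)) ⟩
      (suc m ℕ.+ d) · x   ∎

  0≮-1 : ¬ 0# < - 1#
  0≮-1 0<-1 = <-irrefl refl (<-respʳ-≈ (-‿inverseʳ 1#) (+-pos 0<1 0<-1))

  x<0⇒0<-x : ∀ {x} → x < 0# → 0# < - x
  x<0⇒0<-x {x} x<0 = <-respˡ-≈ (-‿inverseʳ x) (<-respʳ-≈ (+-identityˡ (- x)) (+-monoˡ-< (- x) x<0))

  fromℕ*x≈n·x : ∀ n x → fromℕ n * x ≈ n · x
  fromℕ*x≈n·x n x = trans (×-assoc-* n 1# x) (×-congʳ n (*-identityˡ x))

  module _ (n : ℕ) .{{_ : NonZero n}} where
    private
      n⁻¹ = proj₁ (#⇒invertible (fromℕ#0 n))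

      n*n⁻¹≈1 : fromℕ n * n⁻¹ ≈ 1#
      n*n⁻¹≈1 = trans (*-congʳ (sym (x-0≈x (fromℕ n)))) (proj₂ (proj₂ (#⇒invertible (fromℕ#0 n))))

      0<n : 0# < fromℕ n
      0<n = <-respʳ-≈ (×-congˡ (ℕ.suc-pred n)) (0<fromℕ (ℕ.pred n))

      -- An invertible element is apart from 0 and so has a sign. A negative inverse would make - 1
      -- = n (- n⁻¹) a product of positive numbers.
      0<n⁻¹ : 0# < n⁻¹
      0<n⁻¹ with Equivalence.to #⇔<⊎> (invertibleˡ⇒# (fromℕ n , trans (*-congˡ (x-0≈x n⁻¹)) n*n⁻¹≈1))
      ... | inj₂ 0<n⁻¹ = 0<n⁻¹
      ... | inj₁ n⁻¹<0 = contradiction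
        (<-respʳ-≈ (trans (sym (-‿distribʳ-* _ _)) (-‿cong n*n⁻¹≈1)) (*-pos 0<n (x<0⇒0<-x n⁻¹<0)))
        0≮-1

    n·[x/n]≈x : ∀ x → n · (x / n) ≈ x
    n·[x/n]≈x x = begin
      n · (x * n⁻¹)        ≈⟨ ×-comm-* n x n⁻¹ ⟨
      x * (n · n⁻¹)        ≈⟨ *-congˡ (fromℕ*x≈n·x n n⁻¹) ⟨
      x * (fromℕ n * n⁻¹)  ≈⟨ *-congˡ n*n⁻¹≈1 ⟩
      x * 1#               ≈⟨ *-identityʳ x ⟩
      x                    ∎

    /-pos : ∀ {x} → 0# < x → 0# < x / n
    /-pos 0<x = *-pos 0<x 0<n⁻¹

  x/2+x/2≈x : ∀ x → x / 2 + x / 2 ≈ x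
  x/2+x/2≈x x = trans (+-congˡ (sym (+-identityʳ (x / 2)))) (n·[x/n]≈x 2 x)

  ·-distrib-neg : ∀ n x → n · (- x) ≈ - (n · x)
  ·-distrib-neg n x = begin
    n · (- x)          ≈⟨ fromℕ*x≈n·x n (- x) ⟨
    fromℕ n * - x      ≈⟨ -‿distribʳ-* (fromℕ n) x ⟨
    - (fromℕ n * x)    ≈⟨ -‿cong (fromℕ*x≈n·x n x) ⟩
    - (n · x)          ∎

  [-x][-y]≈xy : ∀ x y → - x * - y ≈ x * y
  [-x][-y]≈xy x y = begin
    - x * - y      ≈⟨ -‿distribˡ-* x (- y) ⟨
    - (x * - y)    ≈⟨ -‿cong (-‿distribʳ-* x y) ⟨
    - - (x * y)    ≈⟨ -‿involutive (x * y) ⟩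
    x * y          ∎

-- Trigonometric identities from the axioms, and the sign of sin (r π / N).

module Trigonometry {R : RealNumbers c ℓ₁ ℓ₂ ℓ₃} (C : CircularFunctions R) where
  open RealNumbers R
  open RealProperties R
  open CircularFunctions C
  open SetoidReasoning (CommutativeRing.setoid commutativeRing)

  cos²+sin²≈1 : ∀ x → cos x * cos x + sin x * sin x ≈ 1#
  cos²+sin²≈1 x = begin
    cos x * cos x + sin x * sin x  ≈⟨ cos-sub x x ⟨
    cos (x - x)                    ≈⟨ cos-cong (-‿inverseʳ x) ⟩
    cos 0#                         ≈⟨ cos-0 ⟩
    1#                             ∎

  private
    1+x≈1⇒x≈0 : ∀ {x} → 1# + x ≈ 1# → x ≈ 0#
    1+x≈1⇒x≈0 {x} eq = +-cancelˡ 1# x 0# (trans eq (sym (+-identityʳ 1#)))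

  sin-0 : sin 0# ≈ 0#
  sin-0 = x*x≈0⇒x≈0 (1+x≈1⇒x≈0 (begin
    1# + sin 0# * sin 0#               ≈⟨ +-congʳ (trans (*-cong cos-0 cos-0) (*-identityˡ 1#)) ⟨
    cos 0# * cos 0# + sin 0# * sin 0#  ≈⟨ cos²+sin²≈1 0# ⟩
    1#                                 ∎))

  cos-π/2 : cos (π / 2) ≈ 0#
  cos-π/2 = x*x≈0⇒x≈0 (1+x≈1⇒x≈0 (begin
    1# + cos (π / 2) * cos (π / 2)                               ≈⟨ +-comm _ _ ⟩
    cos (π / 2) * cos (π / 2) + 1#                               ≈⟨ +-congˡ (trans (*-cong sin-π/2 sin-π/2) (*-identityˡ 1#)) ⟨
    cos (π / 2) * cos (π / 2) + sin (π / 2) * sin (π / 2)        ≈⟨ cos²+sin²≈1 (π / 2) ⟩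
    1#                                                           ∎))

  cos-even : ∀ x → cos (- x) ≈ cos x
  cos-even x = begin
    cos (- x)                        ≈⟨ cos-cong (+-identityˡ (- x)) ⟨
    cos (0# - x)                     ≈⟨ cos-sub x 0# ⟩
    cos 0# * cos x + sin 0# * sin x  ≈⟨ +-cong (*-congʳ cos-0) (*-congʳ sin-0) ⟩
    1# * cos x + 0# * sin x          ≈⟨ +-cong (*-identityˡ _) (zeroˡ _) ⟩
    cos x + 0#                       ≈⟨ +-identityʳ _ ⟩
    cos x                            ∎

  cos[π/2-x]≈sin : ∀ x → cos (π / 2 - x) ≈ sin x
  cos[π/2-x]≈sin x = begin
    cos (π / 2 - x)                            ≈⟨ cos-sub x (π / 2) ⟩
    cos (π / 2) * cos x + sin (π / 2) * sin x  ≈⟨ +-cong (*-congʳ cos-π/2) (*-congʳ sin-π/2) ⟩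
    0# * cos x + 1# * sin x                    ≈⟨ +-cong (zeroˡ _) (*-identityˡ _) ⟩
    0# + sin x                                 ≈⟨ +-identityˡ _ ⟩
    sin x                                      ∎

  sin[π/2-x]≈cos : ∀ x → sin (π / 2 - x) ≈ cos x
  sin[π/2-x]≈cos x = begin
    sin (π / 2 - x)            ≈⟨ cos[π/2-x]≈sin _ ⟨
    cos (π / 2 - (π / 2 - x))  ≈⟨ cos-cong lemma ⟩
    cos x                      ∎
    where
    lemma : π / 2 - (π / 2 - x) ≈ x
    lemma = begin
      π / 2 - (π / 2 - x)          ≈⟨ +-congˡ (-‿+-comm (π / 2) (- x)) ⟨
      π / 2 + (- (π / 2) - - x)    ≈⟨ +-assoc _ _ _ ⟨
      (π / 2 - π / 2) - - x        ≈⟨ +-cong (-‿inverseʳ _) (-‿involutive x) ⟩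
      0# + x                       ≈⟨ +-identityˡ x ⟩
      x                            ∎

  sin-odd : ∀ x → sin (- x) ≈ - sin x
  sin-odd x = begin
    sin (- x)                                            ≈⟨ cos[π/2-x]≈sin (- x) ⟨
    cos (π / 2 - - x)                                    ≈⟨ cos-cong rearrange ⟩
    cos (x - - (π / 2))                                  ≈⟨ cos-sub (- (π / 2)) x ⟩
    cos x * cos (- (π / 2)) + sin x * sin (- (π / 2))    ≈⟨ +-cong (*-congˡ (trans (cos-even _) cos-π/2)) (*-congˡ sin[-π/2]≈-1) ⟩
    cos x * 0# + sin x * - 1#                            ≈⟨ +-cong (zeroʳ _) (trans (sym (-‿distribʳ-* _ _)) (-‿cong (*-identityʳ _))) ⟩
    0# - sin x                                           ≈⟨ +-identityˡ _ ⟩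
    - sin x                                              ∎
    where
    rearrange : π / 2 - - x ≈ x - - (π / 2)
    rearrange = begin
      π / 2 - - x      ≈⟨ +-congˡ (-‿involutive x) ⟩
      π / 2 + x        ≈⟨ +-comm _ _ ⟩
      x + π / 2        ≈⟨ +-congˡ (-‿involutive _) ⟨
      x - - (π / 2)    ∎
    sin[-π/2]≈-1 : sin (- (π / 2)) ≈ - 1#
    sin[-π/2]≈-1 = begin
      sin (- (π / 2))            ≈⟨ cos[π/2-x]≈sin _ ⟨
      cos (π / 2 - - (π / 2))    ≈⟨ cos-cong (trans (+-congˡ (-‿involutive _)) (x/2+x/2≈x π)) ⟩
      cos π                      ≈⟨ cos-π ⟩
      - 1#                       ∎

  cos-+ : ∀ x y → cos (x + y) ≈ cos x * cos y - sin x * sin y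
  cos-+ x y = begin
    cos (x + y)                            ≈⟨ cos-cong (+-congˡ (-‿involutive y)) ⟨
    cos (x - - y)                          ≈⟨ cos-sub (- y) x ⟩
    cos x * cos (- y) + sin x * sin (- y)  ≈⟨ +-cong (*-congˡ (cos-even y)) (trans (*-congˡ (sin-odd y)) (sym (-‿distribʳ-* _ _))) ⟩
    cos x * cos y - sin x * sin y          ∎

  sin-+ : ∀ x y → sin (x + y) ≈ cos x * sin y + sin x * cos y
  sin-+ x y = begin
    sin (x + y)                                        ≈⟨ cos[π/2-x]≈sin _ ⟨
    cos (π / 2 - (x + y))                              ≈⟨ cos-cong (trans (+-congˡ (sym (-‿+-comm x y))) (sym (+-assoc _ _ _))) ⟩
    cos ((π / 2 - x) - y)                              ≈⟨ cos-sub y (π / 2 - x) ⟩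
    cos (π / 2 - x) * cos y + sin (π / 2 - x) * sin y  ≈⟨ +-cong (*-congʳ (cos[π/2-x]≈sin x)) (*-congʳ (sin[π/2-x]≈cos x)) ⟩
    sin x * cos y + cos x * sin y                      ≈⟨ +-comm _ _ ⟩
    cos x * sin y + sin x * cos y                      ∎

  sin-π : sin π ≈ 0#
  sin-π = begin
    sin π                                                                ≈⟨ sin-cong (x/2+x/2≈x π) ⟨
    sin (π / 2 + π / 2)                                                  ≈⟨ sin-+ _ _ ⟩
    cos (π / 2) * sin (π / 2) + sin (π / 2) * cos (π / 2)                ≈⟨ +-cong (*-congʳ cos-π/2) (*-congˡ cos-π/2) ⟩
    0# * sin (π / 2) + sin (π / 2) * 0#                                  ≈⟨ +-cong (zeroˡ _) (zeroʳ _) ⟩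
    0# + 0#                                                              ≈⟨ +-identityˡ 0# ⟩
    0#                                                                   ∎

  sin[π-x]≈sin : ∀ x → sin (π - x) ≈ sin x
  sin[π-x]≈sin x = begin
    sin (π - x)                              ≈⟨ sin-+ π (- x) ⟩
    cos π * sin (- x) + sin π * cos (- x)    ≈⟨ +-cong (*-cong cos-π (sin-odd x)) (*-congʳ sin-π) ⟩
    - 1# * - sin x + 0# * cos (- x)          ≈⟨ +-cong (-1*x≈-x _) (zeroˡ _) ⟩
    - - sin x + 0#                           ≈⟨ +-identityʳ _ ⟩
    - - sin x                                ≈⟨ -‿involutive _ ⟩
    sin x                                    ∎

  0<sin : ∀ {x} → 0# < x → x < π / 2 → 0# < sin x
  0<sin 0<x x<π/2 = <-trans (*-pos 0<x (0<cos 0<x x<π/2)) (xcos<sin 0<x x<π/2)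

  -- Compare cos² - sin² = 1 with cos² + sin² = 1. The doubled square is left undivided, since a sum
  -- of two positive numbers already contradicts it.
  cos[y+y]≈1⇒2sin²≈0 : ∀ y → cos (y + y) ≈ 1# → sin y * sin y + sin y * sin y ≈ 0#
  cos[y+y]≈1⇒2sin²≈0 y cos≈1 = +-cancelˡ (c² - s²) _ _ (begin
    (c² - s²) + (s² + s²)  ≈⟨ +-assoc _ _ _ ⟩
    c² + (- s² + (s² + s²)) ≈⟨ +-congˡ (+-assoc _ _ _) ⟨
    c² + ((- s² + s²) + s²) ≈⟨ +-congˡ (+-congʳ (-‿inverseˡ s²)) ⟩
    c² + (0# + s²)          ≈⟨ +-congˡ (+-identityˡ s²) ⟩
    c² + s²                 ≈⟨ cos²+sin²≈1 y ⟩
    1#                      ≈⟨ cos≈1 ⟨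
    cos (y + y)             ≈⟨ cos-+ y y ⟩
    c² - s²                 ≈⟨ +-identityʳ _ ⟨
    (c² - s²) + 0#          ∎)
    where
    c² = cos y * cos y
    s² = sin y * sin y

  module _ (N : ℕ) .{{_ : NonZero N}} where
    private
      θ = π / N
      η = θ / 2

      [2r]·η≈r·θ : ∀ r → (r ℕ.* 2) · η ≈ r · θ
      [2r]·η≈r·θ r = trans (sym (×-assocˡ η r 2)) (×-congʳ r (n·[x/n]≈x 2 θ))

      N·η≈π/2 : N · η ≈ π / 2
      N·η≈π/2 = trans (sym (×-assoc-* N θ _)) (*-congʳ (n·[x/n]≈x N π))

      -- In multiples of the half angle `η` one has r θ = 2 r η and π / 2 = N η, so that r θ < π / 2
      -- becomes the inequality 2 r < N of natural numbers.
      0<sin-small : ∀ {r} → 0 ℕ.< r → r ℕ.* 2 ℕ.< N → 0# < sin (r · θ)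
      0<sin-small {suc r} _ 2r<N = 0<sin (·-pos r (/-pos N 0<π))
        (<-respˡ-≈ ([2r]·η≈r·θ (suc r)) (<-respʳ-≈ N·η≈π/2 (·-monoˡ-< (/-pos 2 (/-pos N 0<π)) 2r<N)))

    -- The axioms give positivity only strictly between 0 and π / 2. The midpoint is `sin-π/2`, and
    -- a larger angle is reflected by sin (π - x) = sin x, which replaces r by o = N - r.
    0<sin[rπ/N] : ∀ {r} → 0 ℕ.< r → r ℕ.< N → 0# < sin (r · (π / N))
    0<sin[rπ/N] {r} 0<r r<N with ℕ.<-cmp (r ℕ.* 2) N
    ... | tri< 2r<N _ _ = 0<sin-small 0<r 2r<N
    ... | tri≈ _ 2r≡N _ = <-respʳ-≈ (sym (begin
      sin (r · θ)          ≈⟨ sin-cong ([2r]·η≈r·θ r) ⟨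
      sin ((r ℕ.* 2) · η)  ≈⟨ sin-cong (×-congˡ 2r≡N) ⟩
      sin (N · η)          ≈⟨ sin-cong N·η≈π/2 ⟩
      sin (π / 2)          ≈⟨ sin-π/2 ⟩
      1#                   ∎)) 0<1
    ... | tri> _ _ N<2r with o , r+o≡N ← ℕ.m≤n⇒∃[o]m+o≡n (ℕ.<⇒≤ r<N) =
      <-respʳ-≈ (begin
        sin (o · θ)                  ≈⟨ sin-cong o·θ≈π-r·θ ⟩
        sin (π - r · θ)              ≈⟨ sin[π-x]≈sin _ ⟩
        sin (r · θ)                  ∎)
      (0<sin-small
        (ℕ.+-cancelˡ-< r 0 o (≡.subst₂ ℕ._<_ (≡.sym (ℕ.+-identityʳ r)) (≡.sym r+o≡N) r<N))
        -- 2 o < N follows by cancelling N in N + 2 o < 2 r + 2 o = 2 N.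
        (ℕ.+-cancelˡ-< N (o ℕ.* 2) N (ℕ.≤-trans (ℕ.+-monoˡ-< (o ℕ.* 2) N<2r)
          (ℕ.≤-reflexive (≡.trans (≡.sym (ℕ.*-distribʳ-+ 2 r o))
            (≡.trans (≡.cong (ℕ._* 2) r+o≡N) (≡.trans (ℕ.*-comm N 2) (≡.cong (N ℕ.+_) (ℕ.+-identityʳ N)))))))))
      where
      o·θ≈π-r·θ : o · θ ≈ π - r · θ
      o·θ≈π-r·θ = +-cancelˡ (r · θ) _ _ (begin
        r · θ + o · θ              ≈⟨ ×-homo-+ θ r o ⟨
        (r ℕ.+ o) · θ              ≈⟨ ×-congˡ r+o≡N ⟩
        N · θ                      ≈⟨ n·[x/n]≈x N π ⟩
        π                          ≈⟨ +-identityʳ π ⟨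
        π + 0#                     ≈⟨ +-congˡ (-‿inverseˡ _) ⟨
        π + (- (r · θ) + r · θ)    ≈⟨ +-assoc _ _ _ ⟨
        (π - r · θ) + r · θ        ≈⟨ +-comm _ _ ⟩
        r · θ + (π - r · θ)        ∎)

    cos[2rπ/N]≉1 : ∀ {r} → 0 ℕ.< r → r ℕ.< N → ¬ cos (r · (π / N) + r · (π / N)) ≈ 1#
    cos[2rπ/N]≉1 {r} 0<r r<N cos≈1 =
      <-irrefl (sym (cos[y+y]≈1⇒2sin²≈0 _ cos≈1)) (+-pos 0<sin² 0<sin²)
      where
      0<sin² = *-pos (0<sin[rπ/N] 0<r r<N) (0<sin[rπ/N] 0<r r<N)

-- Complex multiplication and integer powers of unimodular numbers.

module ComplexProperties (R : RealNumbers c ℓ₁ ℓ₂ ℓ₃) where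
  open ComplexNumbers R
  private
    module ℝ where
      open RealNumbers R public
      open RealProperties R public

    -- Writing x - y as x + m * y with m = -1 turns the identities below into
    -- commutative semiring identities.
    m : ℝ.Carrier
    m = ℝ.- ℝ.1#

    minus : ∀ x y → x ℝ.- y ℝ.≈ x ℝ.+ m ℝ.* y
    minus x y = ℝ.+-congˡ (ℝ.sym (ℝ.-1*x≈-x y))

  *-cong : ∀ {z z′ w w′} → z ≈ z′ → w ≈ w′ → z * w ≈ z′ * w′
  *-cong (a , b) (x , y) =
    ℝ.+-cong (ℝ.*-cong a x) (ℝ.-‿cong (ℝ.*-cong b y)) ,
    ℝ.+-cong (ℝ.*-cong a y) (ℝ.*-cong b x)

  *-comm : ∀ z w → z * w ≈ w * z
  *-comm (a +i b) (x +i y) =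
    ℝ.+-cong (ℝ.*-comm a x) (ℝ.-‿cong (ℝ.*-comm b y)) ,
    ℝ.trans (ℝ.+-comm _ _) (ℝ.+-cong (ℝ.*-comm b x) (ℝ.*-comm a y))

  *-assoc : ∀ z w v → (z * w) * v ≈ z * (w * v)
  *-assoc (a +i b) (x +i y) (u +i v) =
    ℝ.trans (ℝ.trans (minus _ _) (ℝ.+-congʳ (ℝ.*-congʳ (minus _ _))))
      (ℝ.trans
        (solve 7 (λ m a b x y u v →
          (a :* x :+ m :* (b :* y)) :* u :+ m :* ((a :* y :+ b :* x) :* v) :=
          a :* (x :* u :+ m :* (y :* v)) :+ m :* (b :* (x :* v :+ y :* u))) ℝ.refl m a b x y u v)
        (ℝ.sym (ℝ.trans (minus _ _) (ℝ.+-congʳ (ℝ.*-congˡ (minus _ _)))))) ,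
    ℝ.trans (ℝ.+-congʳ (ℝ.*-congʳ (minus _ _)))
      (ℝ.trans
        (solve 7 (λ m a b x y u v →
          (a :* x :+ m :* (b :* y)) :* v :+ (a :* y :+ b :* x) :* u :=
          a :* (x :* v :+ y :* u) :+ b :* (x :* u :+ m :* (y :* v))) ℝ.refl m a b x y u v)
        (ℝ.sym (ℝ.+-congˡ (ℝ.*-congˡ (minus _ _)))))
    where open SemiringSolver (CommutativeRing.commutativeSemiring ℝ.commutativeRing)

  *-identityˡ : ∀ z → 1ℂ * z ≈ z
  *-identityˡ (a +i b) =
    ℝ.trans (ℝ.+-cong (ℝ.*-identityˡ a) (ℝ.trans (ℝ.-‿cong (ℝ.zeroˡ b)) ℝ.-0#≈0#)) (ℝ.+-identityʳ a) ,
    ℝ.trans (ℝ.+-cong (ℝ.*-identityˡ b) (ℝ.zeroˡ a)) (ℝ.+-identityʳ b)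

  *-commutativeMonoid : CommutativeMonoid c ℓ₁
  *-commutativeMonoid = record
    { Carrier = ℂ
    ; _≈_     = _≈_
    ; _∙_     = _*_
    ; ε       = 1ℂ
    ; isCommutativeMonoid = record
      { isMonoid = record
        { isSemigroup = record
          { isMagma = record
            { isEquivalence = record
              { refl  = ℝ.refl , ℝ.refl
              ; sym   = λ (p , q) → ℝ.sym p , ℝ.sym q
              ; trans = λ (p , q) (p′ , q′) → ℝ.trans p p′ , ℝ.trans q q′
              }
            ; ∙-cong = *-cong
            }
          ; assoc = *-assoc
          }
        ; identity = *-identityˡ , λ z →
            let p , q = *-identityˡ z ; r , s = *-comm z 1ℂ in ℝ.trans r p , ℝ.trans s q
        }
      ; comm = *-comm
      }
    }

  open CommutativeMonoid *-commutativeMonoid public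
    using (setoid; refl; sym; trans; reflexive)
    renaming (∙-congˡ to *-congˡ; ∙-congʳ to *-congʳ; identityʳ to *-identityʳ)
  open MonoidMult (CommutativeMonoid.monoid *-commutativeMonoid) public
    renaming (×-homo-+ to ^-homo-+; ×-congʳ to ^-congˡ; ×-assocˡ to ^-assocˡ) using ()
  open SetoidReasoning setoid

  conj-cong : ∀ {z w} → z ≈ w → conj z ≈ conj w
  conj-cong (p , q) = p , ℝ.-‿cong q

  conj-* : ∀ z w → conj (z * w) ≈ conj z * conj w
  conj-* (a +i b) (x +i y) =
    ℝ.+-congˡ (ℝ.-‿cong (ℝ.sym (ℝ.[-x][-y]≈xy b y))) ,
    ℝ.trans (ℝ.sym (ℝ.-‿+-comm _ _)) (ℝ.+-cong (ℝ.-‿distribʳ-* a y) (ℝ.-‿distribˡ-* b x))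

  unimodular⇒conj-inverse : ∀ {z} → Unimodular z → z * conj z ≈ 1ℂ
  unimodular⇒conj-inverse {a +i b} ∣z∣≈1 =
    ℝ.trans (ℝ.+-congˡ (ℝ.trans (ℝ.-‿distribʳ-* _ _) (ℝ.*-congˡ (ℝ.-‿involutive b)))) ∣z∣≈1 ,
    ℝ.trans (ℝ.+-cong (ℝ.sym (ℝ.-‿distribʳ-* a b)) (ℝ.*-comm b a)) (ℝ.-‿inverseˡ _)

  z≈1⇒zⁿ≈1 : ∀ {z} n → z ≈ 1ℂ → z ^ n ≈ 1ℂ
  z≈1⇒zⁿ≈1 zero    z≈1 = refl
  z≈1⇒zⁿ≈1 (suc n) z≈1 = trans (*-cong z≈1 (z≈1⇒zⁿ≈1 n z≈1)) (*-identityˡ 1ℂ)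

  module UnimodularPower {z : ℂ} (∣z∣≈1 : Unimodular z) where

    -- Integer sums of mixed sign reduce to `m ⊖ n`, so this settles the two mixed cases of
    -- `^ᶻ-homo-+`. The induction cancels one z against one conj z.
    ^ᶻ-⊖ : ∀ m n → z ^ᶻ (m ⊖ n) ≈ z ^ m * conj z ^ n
    ^ᶻ-⊖ zero    zero    = sym (*-identityˡ 1ℂ)
    ^ᶻ-⊖ zero    (suc n) = sym (*-identityˡ _)
    ^ᶻ-⊖ (suc m) zero    = sym (*-identityʳ _)
    ^ᶻ-⊖ (suc m) (suc n) = begin
      z ^ᶻ (suc m ⊖ suc n)                     ≡⟨ ≡.cong (z ^ᶻ_) (ℤ.[1+m]⊖[1+n]≡m⊖n m n) ⟩
      z ^ᶻ (m ⊖ n)                             ≈⟨ ^ᶻ-⊖ m n ⟩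
      z ^ m * conj z ^ n                       ≈⟨ *-identityˡ _ ⟨
      1ℂ * (z ^ m * conj z ^ n)                ≈⟨ *-congʳ (unimodular⇒conj-inverse ∣z∣≈1) ⟨
      (z * conj z) * (z ^ m * conj z ^ n)      ≈⟨ interchange z (conj z) (z ^ m) (conj z ^ n) ⟩
      (z * z ^ m) * (conj z * conj z ^ n)      ∎
      where
      open import Algebra.Properties.CommutativeSemigroup
        (CommutativeMonoid.commutativeSemigroup *-commutativeMonoid) using (interchange)

    ^ᶻ-homo-+ : ∀ i j → z ^ᶻ (i ℤ.+ j) ≈ z ^ᶻ i * z ^ᶻ j
    ^ᶻ-homo-+ (+ m)      (+ n)      = ^-homo-+ z m n
    ^ᶻ-homo-+ (+ m)      (-[1+ n ]) = ^ᶻ-⊖ m (suc n)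
    ^ᶻ-homo-+ (-[1+ m ]) (+ n)      = trans (^ᶻ-⊖ n (suc m)) (*-comm _ _)
    ^ᶻ-homo-+ (-[1+ m ]) (-[1+ n ]) = trans
      (reflexive (≡.cong (λ k → conj z ^ suc k) (≡.sym (ℕ.+-suc m n))))
      (^-homo-+ (conj z) (suc m) (suc n))

    ^ᶻ-inverse : ∀ i → z ^ᶻ (ℤ.- i) * z ^ᶻ i ≈ 1ℂ
    ^ᶻ-inverse i = trans (sym (^ᶻ-homo-+ (ℤ.- i) i)) (reflexive (≡.cong (z ^ᶻ_) (ℤ.+-inverseˡ i)))

    ^ᶻ-periodic : ∀ {n} → z ^ n ≈ 1ℂ → ∀ q → z ^ᶻ (q ℤ.* + n) ≈ 1ℂ
    ^ᶻ-periodic {n} zⁿ≈1 (+ k) = begin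
      z ^ᶻ (+ k ℤ.* + n)   ≡⟨ ≡.cong (z ^ᶻ_) (ℤ.pos-* k n) ⟨
      z ^ (k ℕ.* n)        ≈⟨ ^-assocˡ z k n ⟨
      (z ^ n) ^ k          ≈⟨ z≈1⇒zⁿ≈1 k zⁿ≈1 ⟩
      1ℂ                   ∎
    -- Multiplying by the power for `- q`, which is 1 by the first clause, cancels the exponent.
    ^ᶻ-periodic {n} zⁿ≈1 q@(-[1+ k ]) = begin
      z ^ᶻ (q ℤ.* + n)                                 ≈⟨ *-identityʳ _ ⟨
      z ^ᶻ (q ℤ.* + n) * 1ℂ                            ≈⟨ *-congˡ (^ᶻ-periodic {n} zⁿ≈1 (ℤ.- q)) ⟨
      z ^ᶻ (q ℤ.* + n) * z ^ᶻ (ℤ.- q ℤ.* + n)          ≈⟨ ^ᶻ-homo-+ (q ℤ.* + n) (ℤ.- q ℤ.* + n) ⟨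
      z ^ᶻ (q ℤ.* + n ℤ.+ ℤ.- q ℤ.* + n)               ≡⟨ ≡.cong (z ^ᶻ_) (cancel q (+ n)) ⟩
      1ℂ                                               ∎
      where
      cancel : ∀ q n → q ℤ.* n ℤ.+ ℤ.- q ℤ.* n ≡ + 0
      cancel = solve-∀

    ^ᶻ-cong-mod : ∀ {n} → z ^ n ≈ 1ℂ → ∀ i j → + n ∣ᶻ i ℤ.- j → z ^ᶻ i ≈ z ^ᶻ j
    ^ᶻ-cong-mod {n} zⁿ≈1 i j (divides q i-j≡qn) = begin
      z ^ᶻ i                         ≡⟨ ≡.cong (z ^ᶻ_) (split i j) ⟩
      z ^ᶻ ((i ℤ.- j) ℤ.+ j)         ≡⟨ ≡.cong (λ k → z ^ᶻ (k ℤ.+ j)) i-j≡qn ⟩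
      z ^ᶻ (q ℤ.* + n ℤ.+ j)         ≈⟨ ^ᶻ-homo-+ (q ℤ.* + n) j ⟩
      z ^ᶻ (q ℤ.* + n) * z ^ᶻ j      ≈⟨ *-congʳ (^ᶻ-periodic {n} zⁿ≈1 q) ⟩
      1ℂ * z ^ᶻ j                    ≈⟨ *-identityˡ _ ⟩
      z ^ᶻ j                         ∎
      where
      split : ∀ i j → i ≡ (i ℤ.- j) ℤ.+ j
      split = solve-∀

-- The order of the root of unity.

module RootOfUnity {R : RealNumbers c ℓ₁ ℓ₂ ℓ₃} (C : CircularFunctions R)
                   (N : ℕ) .{{_ : NonZero N}} where
  open CircularFunctions C
  open ComplexNumbers R
  open ComplexProperties R
  open Trigonometry C
  open Sequences C N using (ζ)
  open SetoidReasoning setoid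
  private
    module ℝ where
      open RealNumbers R public
      open RealProperties R public

    exp : ℝ.Carrier → ℂ
    exp x = cos x +i sin x

    exp-cong : ∀ {x y} → x ℝ.≈ y → exp x ≈ exp y
    exp-cong x≈y = cos-cong x≈y , sin-cong x≈y

    exp-· : ∀ n x → exp (n ℝ.· x) ≈ exp x ^ n
    exp-· zero    x = cos-0 , sin-0
    exp-· (suc n) x = trans (cos-+ x (n ℝ.· x) , sin-+ x (n ℝ.· x)) (*-congˡ (exp-· n x))

    θ = π ℝ./ N

  ζ-unimodular : Unimodular ζ
  ζ-unimodular = cos²+sin²≈1 (ℝ.- θ)

  open UnimodularPower ζ-unimodular

  ζ^N≈-1 : ζ ^ N ≈ (ℝ.- ℝ.1#) +i ℝ.0#
  ζ^N≈-1 = begin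
    ζ ^ N                      ≈⟨ exp-· N (ℝ.- θ) ⟨
    exp (N ℝ.· (ℝ.- θ))        ≈⟨ exp-cong (ℝ.trans (ℝ.·-distrib-neg N θ) (ℝ.-‿cong (ℝ.n·[x/n]≈x N π))) ⟩
    exp (ℝ.- π)                ≈⟨ ℝ.trans (cos-even π) cos-π , ℝ.trans (sin-odd π) (ℝ.trans (ℝ.-‿cong sin-π) ℝ.-0#≈0#) ⟩
    (ℝ.- ℝ.1#) +i ℝ.0#         ∎

  ζ^2N≈1 : ζ ^ (2 ℕ.* N) ≈ 1ℂ
  ζ^2N≈1 = begin
    ζ ^ (2 ℕ.* N)              ≈⟨ ^-assocˡ ζ 2 N ⟨
    (ζ ^ N) ^ 2                ≈⟨ ^-congˡ 2 ζ^N≈-1 ⟩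
    -1ℂ * (-1ℂ * 1ℂ)           ≈⟨ *-congˡ (*-identityʳ -1ℂ) ⟩
    -1ℂ * -1ℂ                  ≈⟨ -1*-1≈1 ⟩
    1ℂ                         ∎
    where
    -1ℂ = (ℝ.- ℝ.1#) +i ℝ.0#
    -1*-1≈1 : -1ℂ * -1ℂ ≈ 1ℂ
    -1*-1≈1 =
      ℝ.trans (ℝ.+-cong (ℝ.trans (ℝ.[-x][-y]≈xy _ _) (ℝ.*-identityˡ _))
        (ℝ.trans (ℝ.-‿cong (ℝ.zeroˡ _)) ℝ.-0#≈0#)) (ℝ.+-identityʳ _) ,
      ℝ.trans (ℝ.+-cong (ℝ.zeroʳ _) (ℝ.zeroˡ _)) (ℝ.+-identityʳ _)

  ζ^ᶻ-cong : ∀ i j → + (2 ℕ.* N) ∣ᶻ i ℤ.- j → ζ ^ᶻ i ≈ ζ ^ᶻ j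
  ζ^ᶻ-cong = ^ᶻ-cong-mod {2 ℕ.* N} ζ^2N≈1

  private
    -- The real part of ζ^(2 r) is cos (2 r π / N), which cannot be 1 when 0 < r < N.
    ζ^2r≈1⇒r≡0 : ∀ {r} → r ℕ.< N → ζ ^ (r ℕ.+ r) ≈ 1ℂ → r ≡ 0
    ζ^2r≈1⇒r≡0 {zero}  r<N eq = ≡.refl
    ζ^2r≈1⇒r≡0 {r@(suc _)} r<N eq = contradiction
      (ℝ.trans (ℝ.trans (ℝ.sym (cos-even _)) (cos-cong lemma)) (proj₁ (trans (exp-· (r ℕ.+ r) (ℝ.- θ)) eq)))
      (cos[2rπ/N]≉1 N ℕ.z<s r<N)
      where
      lemma : ℝ.- (r ℝ.· θ ℝ.+ r ℝ.· θ) ℝ.≈ (r ℕ.+ r) ℝ.· (ℝ.- θ)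
      lemma = ℝ.trans (ℝ.-‿cong (ℝ.sym (ℝ.×-homo-+ θ r r))) (ℝ.sym (ℝ.·-distrib-neg (r ℕ.+ r) θ))

  -- `W` = ζ² has order exactly N: for the remainder r of i modulo N, the exponents 2 i and 2 r
  -- differ by a multiple of 2 N, so r falls under the previous lemma.
  ζ^ᶻ2i≈1⇒N∣i : ∀ {i} → ζ ^ᶻ (+ 2 ℤ.* i) ≈ 1ℂ → + N ∣ᶻ i
  ζ^ᶻ2i≈1⇒N∣i {i} eq = divides q (≡.trans (a≡a%ℕn+[a/ℕn]*n i N) (≡.trans (≡.cong (λ k → + k ℤ.+ q ℤ.* + N) r≡0) (ℤ.+-identityˡ _)))
    where
    q = i /ℕ N
    r = i %ℕ N
    difference : ∀ r q n → (r ℤ.+ r) ℤ.- + 2 ℤ.* (r ℤ.+ q ℤ.* n) ≡ ℤ.- q ℤ.* (+ 2 ℤ.* n)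
    difference = solve-∀
    r≡0 : r ≡ 0
    r≡0 = ζ^2r≈1⇒r≡0 (n%ℕd<d i N) (trans (ζ^ᶻ-cong (+ (r ℕ.+ r)) (+ 2 ℤ.* i) (divides (ℤ.- q)
      (≡.trans (≡.cong₂ (λ x y → x ℤ.- + 2 ℤ.* y) (ℤ.pos-+ r r) (a≡a%ℕn+[a/ℕn]*n i N))
        (≡.trans (difference (+ r) q (+ N)) (≡.cong (ℤ.- q ℤ.*_) (≡.sym (ℤ.pos-* 2 N))))))) eq)

-- Self-maps of a finite set.

-- Punching out a missed value would inject a set of n + 1 elements into one of n.
injective⇒surjective : ∀ {n} {f : Fin n → Fin n} → Injective _≡_ _≡_ f → StrictlySurjective _≡_ f
injective⇒surjective {suc n} {f} f-injective y with Fin.any? (λ x → f x Fin.≟ y)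
... | yes hit = hit
... | no miss = contradiction
  (Fin.injective⇒≤ λ {i} {j} → f-injective ∘ Fin.punchOut-injective (y≢f i) (y≢f j))
  ℕ.1+n≰n
  where
  y≢f : ∀ x → y ≢ f x
  y≢f x y≡fx = miss (x , ≡.sym y≡fx)

-- A section of f is injective, hence onto. Every x is thus a value of the section and can be
-- recovered from f x.
surjective⇒injective : ∀ {n} {f : Fin n → Fin n} → StrictlySurjective _≡_ f → Injective _≡_ _≡_ f
surjective⇒injective {f = f} f-surjective {x} {y} fx≡fy = begin
  x            ≡⟨ proj₂ (section-surjective x) ⟨
  section x′   ≡⟨ ≡.cong section x′≡y′ ⟩
  section y′   ≡⟨ proj₂ (section-surjective y) ⟩
  y            ∎
  where
  open ≡.≡-Reasoning
  section = proj₁ ∘ f-surjective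
  f∘section = proj₂ ∘ f-surjective
  section-injective : Injective _≡_ _≡_ section
  section-injective {i} {j} eq = ≡.trans (≡.sym (f∘section i)) (≡.trans (≡.cong f eq) (f∘section j))
  section-surjective = injective⇒surjective section-injective
  x′ = proj₁ (section-surjective x)
  y′ = proj₁ (section-surjective y)
  x′≡y′ : x′ ≡ y′
  x′≡y′ = begin
    x′             ≡⟨ f∘section x′ ⟨
    f (section x′) ≡⟨ ≡.cong f (proj₂ (section-surjective x)) ⟩
    f x            ≡⟨ fx≡fy ⟩
    f y            ≡⟨ ≡.cong f (proj₂ (section-surjective y)) ⟨
    f (section y′) ≡⟨ f∘section y′ ⟩
    y′             ∎

-- Congruences, and residues as images of integers.

module Congruence (n : ℤ) where
  infix 4 _≋_

  -- A record rather than bare divisibility, so that unification can recover `x` and `y`, which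
  -- their difference does not determine.
  record _≋_ (x y : ℤ) : Set where
    constructor congruent
    field ∣-difference : n ∣ᶻ x ℤ.- y
  open _≋_ public

  ≋-reflexive : ∀ {x y} → x ≡ y → x ≋ y
  ≋-reflexive {x} ≡.refl = congruent (divides (+ 0) (ℤ.+-inverseʳ x))

  ≋-refl : ∀ {x} → x ≋ x
  ≋-refl = ≋-reflexive ≡.refl

  ≋-sym : ∀ {x y} → x ≋ y → y ≋ x
  ≋-sym {x} {y} (congruent p) = congruent (≡.subst (n ∣ᶻ_) (lemma x y) (∣m⇒∣-m p))
    where
    lemma : ∀ x y → ℤ.- (x ℤ.- y) ≡ y ℤ.- x
    lemma = solve-∀

  ≋-trans : ∀ {x y z} → x ≋ y → y ≋ z → x ≋ z
  ≋-trans {x} {y} {z} (congruent p) (congruent q) = congruent (≡.subst (n ∣ᶻ_) (lemma x y z) (∣m∣n⇒∣m+n p q))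
    where
    lemma : ∀ x y z → (x ℤ.- y) ℤ.+ (y ℤ.- z) ≡ x ℤ.- z
    lemma = solve-∀

  ≋-+ : ∀ {x y u v} → x ≋ y → u ≋ v → x ℤ.+ u ≋ y ℤ.+ v
  ≋-+ {x} {y} {u} {v} (congruent p) (congruent q) = congruent (≡.subst (n ∣ᶻ_) (lemma x y u v) (∣m∣n⇒∣m+n p q))
    where
    lemma : ∀ x y u v → (x ℤ.- y) ℤ.+ (u ℤ.- v) ≡ (x ℤ.+ u) ℤ.- (y ℤ.+ v)
    lemma = solve-∀

  ≋-* : ∀ {x y u v} → x ≋ y → u ≋ v → x ℤ.* u ≋ y ℤ.* v
  ≋-* {x} {y} {u} {v} (congruent p) (congruent q) = congruent (≡.subst (n ∣ᶻ_) (lemma x y u v) (∣m∣n⇒∣m+n (∣m⇒∣m*n u p) (∣n⇒∣m*n y q)))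
    where
    lemma : ∀ x y u v → (x ℤ.- y) ℤ.* u ℤ.+ y ℤ.* (u ℤ.- v) ≡ (x ℤ.* u) ℤ.- (y ℤ.* v)
    lemma = solve-∀

  ∣-resp-≋ : ∀ {x y} → x ≋ y → n ∣ᶻ x → n ∣ᶻ y
  ∣-resp-≋ {x} {y} (congruent x≋y) n∣x = ≡.subst (n ∣ᶻ_) (lemma x y) (∣m∣n⇒∣m-n n∣x x≋y)
    where
    lemma : ∀ x y → x ℤ.- (x ℤ.- y) ≡ y
    lemma = solve-∀

quadratic : ℤ → ℤ → ℤ → ℤ
quadratic a b x = a ℤ.* (x ℤ.* x) ℤ.+ b ℤ.* x

quadratic-≋ : ∀ n {a a′ b b′ x x′} → let open Congruence n in
  a ≋ a′ → b ≋ b′ → x ≋ x′ → quadratic a b x ≋ quadratic a′ b′ x′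
quadratic-≋ n a≋ b≋ x≋ = ≋-+ (≋-* a≋ (≋-* x≋ x≋)) (≋-* b≋ x≋)
  where open Congruence n

module ResidueProperties (N : ℕ) .{{_ : NonZero N}} where
  open Residues N
  open Congruence (+ N) public

  ⟦_⟧ : ℤ → ℤ/N
  ⟦ x ⟧ = fromℕ< (n%ℕd<d x N)

  toℕ⟦x⟧≋x : ∀ x → + toℕ ⟦ x ⟧ ≋ x
  toℕ⟦x⟧≋x x rewrite Fin.toℕ-fromℕ< (n%ℕd<d x N) = congruent (divides (ℤ.- (x /ℕ N)) (begin
    + (x %ℕ N) ℤ.- x                                             ≡⟨ ≡.cong (λ y → + (x %ℕ N) ℤ.- y) (a≡a%ℕn+[a/ℕn]*n x N) ⟩
    + (x %ℕ N) ℤ.- (+ (x %ℕ N) ℤ.+ (x /ℕ N) ℤ.* + N)             ≡⟨ lemma (+ (x %ℕ N)) (x /ℕ N) (+ N) ⟩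
    ℤ.- (x /ℕ N) ℤ.* + N                                         ∎))
    where
    open ≡.≡-Reasoning
    lemma : ∀ r q n → r ℤ.- (r ℤ.+ q ℤ.* n) ≡ ℤ.- q ℤ.* n
    lemma = solve-∀

  -- Two least residues differ by less than N in absolute value, and 0 is the only multiple of N
  -- that small.
  toℕ-injective-mod : ∀ {i j : ℤ/N} → + toℕ i ≋ + toℕ j → i ≡ j
  toℕ-injective-mod {i} {j} (congruent i≋j) = Fin.toℕ-injective (ℤ.+-injective (ℤ.i-j≡0⇒i≡j _ _ (ℤ.∣i∣≡0⇒i≡0 (multiple<N (∣⇒∣ᵤ i≋j) small))))
    where
    multiple<N : ∀ {m} → N ∣ m → m ℕ.< N → m ≡ 0
    multiple<N {zero}  _   _   = ≡.refl
    multiple<N {suc m} N∣m m<N = contradiction N∣m (>⇒∤ m<N)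
    small : ℤ.∣ + toℕ i ℤ.- + toℕ j ∣ ℕ.< N
    small = ℕ.≤-<-trans
      (≡.subst (λ k → ℤ.∣ k ∣ ℕ.≤ toℕ i ℕ.⊔ toℕ j) (≡.sym (ℤ.m-n≡m⊖n (toℕ i) (toℕ j))) (ℤ.∣m⊝n∣≤m⊔n (toℕ i) (toℕ j)))
      (ℕ.⊔-pres-<m (Fin.toℕ<n i) (Fin.toℕ<n j))

  ⟦⟧-cong : ∀ {x y} → x ≋ y → ⟦ x ⟧ ≡ ⟦ y ⟧
  ⟦⟧-cong {x} {y} x≋y = toℕ-injective-mod (≋-trans (toℕ⟦x⟧≋x x) (≋-trans x≋y (≋-sym (toℕ⟦x⟧≋x y))))

  ⟦⟧-injective : ∀ {x y} → ⟦ x ⟧ ≡ ⟦ y ⟧ → x ≋ y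
  ⟦⟧-injective {x} {y} eq = ≋-trans (≋-sym (toℕ⟦x⟧≋x x)) (≋-trans (≋-reflexive (≡.cong (+_ ∘ toℕ) eq)) (toℕ⟦x⟧≋x y))

  ⟦toℕ⟧ : ∀ k → ⟦ + toℕ k ⟧ ≡ k
  ⟦toℕ⟧ k = toℕ-injective-mod (toℕ⟦x⟧≋x (+ toℕ k))

  ⟦⟧-⊕ : ∀ x y → ⟦ x ⟧ ⊕ ⟦ y ⟧ ≡ ⟦ x ℤ.+ y ⟧
  ⟦⟧-⊕ x y = ⟦⟧-cong (≋-trans (≋-reflexive (ℤ.pos-+ (toℕ ⟦ x ⟧) (toℕ ⟦ y ⟧))) (≋-+ (toℕ⟦x⟧≋x x) (toℕ⟦x⟧≋x y)))

  ⟦⟧-⊗ : ∀ x y → ⟦ x ⟧ ⊗ ⟦ y ⟧ ≡ ⟦ x ℤ.* y ⟧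
  ⟦⟧-⊗ x y = ⟦⟧-cong (≋-trans (≋-reflexive (ℤ.pos-* (toℕ ⟦ x ⟧) (toℕ ⟦ y ⟧))) (≋-* (toℕ⟦x⟧≋x x) (toℕ⟦x⟧≋x y)))

  ⟦⟧-poly : ∀ a b x → poly ⟦ a ⟧ ⟦ b ⟧ ⟦ x ⟧ ≡ ⟦ quadratic a b x ⟧
  ⟦⟧-poly a b x = begin
    ⟦ a ⟧ ⊗ (⟦ x ⟧ ⊗ ⟦ x ⟧) ⊕ ⟦ b ⟧ ⊗ ⟦ x ⟧    ≡⟨ ≡.cong₂ (λ y z → ⟦ a ⟧ ⊗ y ⊕ z) (⟦⟧-⊗ x x) (⟦⟧-⊗ b x) ⟩
    ⟦ a ⟧ ⊗ ⟦ x ℤ.* x ⟧ ⊕ ⟦ b ℤ.* x ⟧          ≡⟨ ≡.cong (_⊕ ⟦ b ℤ.* x ⟧) (⟦⟧-⊗ a (x ℤ.* x)) ⟩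
    ⟦ a ℤ.* (x ℤ.* x) ⟧ ⊕ ⟦ b ℤ.* x ⟧          ≡⟨ ⟦⟧-⊕ (a ℤ.* (x ℤ.* x)) (b ℤ.* x) ⟩
    ⟦ quadratic a b x ⟧                        ∎
    where open ≡.≡-Reasoning

  poly-⟦⟧ : ∀ a b x → poly a b ⟦ x ⟧ ≡ ⟦ quadratic (+ toℕ a) (+ toℕ b) x ⟧
  poly-⟦⟧ a b x = begin
    poly a b ⟦ x ⟧                          ≡⟨ ≡.cong₂ (λ a b → poly a b ⟦ x ⟧) (⟦toℕ⟧ a) (⟦toℕ⟧ b) ⟨
    poly ⟦ + toℕ a ⟧ ⟦ + toℕ b ⟧ ⟦ x ⟧      ≡⟨ ⟦⟧-poly (+ toℕ a) (+ toℕ b) x ⟩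
    ⟦ quadratic (+ toℕ a) (+ toℕ b) x ⟧     ∎
    where open ≡.≡-Reasoning

-- Quadratic permutation polynomials modulo N and modulo its divisors.

quadratic-difference : ∀ a b x y →
  (x ℤ.- y) ℤ.* (a ℤ.* (x ℤ.+ y) ℤ.+ b) ≡
  a ℤ.* (x ℤ.* x) ℤ.+ b ℤ.* x ℤ.- (a ℤ.* (y ℤ.* y) ℤ.+ b ℤ.* y)
quadratic-difference = solve-∀

-- quadratic a b x - quadratic a b y is a multiple of a w + b for w = x + y, and
-- (a w + 1) (1 - a w + a² w²) = 1 + a³ w³.
nilpotent⇒injective-mod : ∀ {n} a b → let open Congruence n in
  n ∣ᶻ a ℤ.* (a ℤ.* a) → b ≋ + 1 → ∀ x y → quadratic a b x ≋ quadratic a b y → x ≋ y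
nilpotent⇒injective-mod {n} a b n∣a³ (Congruence.congruent b≋1) x y (Congruence.congruent eq) =
  Congruence.congruent (≡.subst (n ∣ᶻ_) (identity a b (x ℤ.- y) (x ℤ.+ y))
    (∣m∣n⇒∣m-n
      (∣m∣n⇒∣m-n
        (∣m⇒∣m*n (+ 1 ℤ.- aw ℤ.+ aw ℤ.* aw) (≡.subst (n ∣ᶻ_) (≡.sym (quadratic-difference a b x y)) eq))
        (∣n⇒∣m*n ((x ℤ.- y) ℤ.* (+ 1 ℤ.- aw ℤ.+ aw ℤ.* aw)) b≋1))
      (∣n⇒∣m*n ((x ℤ.- y) ℤ.* (w ℤ.* (w ℤ.* w))) n∣a³)))
  where
  w = x ℤ.+ y
  aw = a ℤ.* w
  identity : ∀ a b d w →
    (d ℤ.* (a ℤ.* w ℤ.+ b)) ℤ.* (+ 1 ℤ.- a ℤ.* w ℤ.+ (a ℤ.* w) ℤ.* (a ℤ.* w))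
      ℤ.- (d ℤ.* (+ 1 ℤ.- a ℤ.* w ℤ.+ (a ℤ.* w) ℤ.* (a ℤ.* w))) ℤ.* (b ℤ.- + 1)
      ℤ.- (d ℤ.* (w ℤ.* (w ℤ.* w))) ℤ.* (a ℤ.* (a ℤ.* a)) ≡ d
  identity = solve-∀

module _ (N : ℕ) .{{_ : NonZero N}} where
  open Residues N
  open ResidueProperties N

  poly-bijective : ∀ (a b : ℤ/N) → (∀ x y → quadratic (+ toℕ a) (+ toℕ b) x ≋ quadratic (+ toℕ a) (+ toℕ b) y → x ≋ y) →
    Bijective _≡_ _≡_ (poly a b)
  poly-bijective a b inj-mod = injective , strictlySurjective⇒surjective (injective⇒surjective injective)
    where
    injective : Injective _≡_ _≡_ (poly a b)
    injective {i} {j} eq = toℕ-injective-mod (inj-mod (+ toℕ i) (+ toℕ j) (⟦⟧-injective (begin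
      ⟦ quadratic (+ toℕ a) (+ toℕ b) (+ toℕ i) ⟧  ≡⟨ poly-⟦⟧ a b (+ toℕ i) ⟨
      poly a b ⟦ + toℕ i ⟧                         ≡⟨ ≡.cong (poly a b) (⟦toℕ⟧ i) ⟩
      poly a b i                                   ≡⟨ eq ⟩
      poly a b j                                   ≡⟨ ≡.cong (poly a b) (⟦toℕ⟧ j) ⟨
      poly a b ⟦ + toℕ j ⟧                         ≡⟨ poly-⟦⟧ a b (+ toℕ j) ⟩
      ⟦ quadratic (+ toℕ a) (+ toℕ b) (+ toℕ j) ⟧  ∎)))
      where open ≡.≡-Reasoning

  -- With N = K r, the condition r ∣ K² gives N ∣ K³, so K X² + X is a permutation; N ∣ 2 K would
  -- mean r ∣ 2. It is applied with r = 4 when 8 ∣ N, with r = p when p² ∣ N, and with r = 3 when 9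
  -- ∣ N.
  nilpotent⇒𝒬-irr : ∀ {K r} → N ≡ K ℕ.* r → r ∣ K ℕ.* K → r ∤ 2 → 𝒬-irr ⟦ + K ⟧ ⟦ + 1 ⟧
  nilpotent⇒𝒬-irr {K} {r} N≡Kr r∣K² r∤2 =
    (poly-bijective ⟦ + K ⟧ ⟦ + 1 ⟧ (nilpotent⇒injective-mod (+ α) (+ toℕ ⟦ + 1 ⟧) N∣α³ (toℕ⟦x⟧≋x (+ 1))) , α≢0)
    , ℕ.≤∧≢⇒< (∣⇒≤ (ℕ.gcd[m,n]∣m N (2 ℕ.* α))) λ gcd≡N → N∤2α (≡.subst (_∣ 2 ℕ.* α) gcd≡N (ℕ.gcd[m,n]∣n N (2 ℕ.* α)))
    where
    α = toℕ ⟦ + K ⟧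

    instance
      K≢0 : NonZero K
      K≢0 = ℕ.m*n≢0⇒m≢0 K {{ℕ.≢-nonZero λ Kr≡0 → ℕ.≢-nonZero⁻¹ N (≡.trans N≡Kr Kr≡0)}}

    N∣K³ : + N ∣ᶻ + K ℤ.* (+ K ℤ.* + K)
    N∣K³ = ∣ᵤ⇒∣ (≡.subst₂ _∣_ (≡.sym N≡Kr)
      (≡.trans (≡.cong (K ℕ.*_) (≡.sym (ℤ.abs-* (+ K) (+ K)))) (≡.sym (ℤ.abs-* (+ K) (+ K ℤ.* + K))))
      (*-monoʳ-∣ K r∣K²))

    α≋K : + α ≋ + K
    α≋K = toℕ⟦x⟧≋x (+ K)

    N∣α³ : + N ∣ᶻ + α ℤ.* (+ α ℤ.* + α)
    N∣α³ = ∣-resp-≋ (≋-sym (≋-* α≋K (≋-* α≋K α≋K))) N∣K³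

    N∤2α : N ∤ 2 ℕ.* α
    N∤2α N∣2α = r∤2 (*-cancelˡ-∣ K (≡.subst₂ _∣_ N≡Kr (≡.trans (ℤ.abs-* (+ 2) (+ K)) (ℕ.*-comm 2 K))
      (∣⇒∣ᵤ (∣-resp-≋ (≋-* (≋-refl {+ 2}) α≋K) (≡.subst (+ N ∣ᶻ_) (ℤ.pos-* 2 α) (∣ᵤ⇒∣ N∣2α))))))

    α≢0 : ⟦ + K ⟧ ≢ 0 mod N
    α≢0 eq = N∤2α (∣⇒∣ᵤ (≡.subst (+ N ∣ᶻ_) (≡.sym (ℤ.pos-* 2 α))
      (∣n⇒∣m*n (+ 2) (∣-resp-≋ (≋-sym (≋-trans (≋-reflexive (≡.cong (+_ ∘ toℕ) eq)) (toℕ⟦x⟧≋x (+ 0)))) (divides (+ 0) ≡.refl)))))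

  module Permutation (a b : ℤ/N) (bijective : Bijective _≡_ _≡_ (poly a b)) where
    private
      α = toℕ a
      β = toℕ b
      f = quadratic (+ α) (+ β)

    surjective-mod : ∀ y → ∃[ x ] f x ≋ y
    surjective-mod y = let k , hit = proj₂ bijective ⟦ y ⟧ in + toℕ k , ⟦⟧-injective {f (+ toℕ k)} {y} (begin
      ⟦ f (+ toℕ k) ⟧        ≡⟨ poly-⟦⟧ a b (+ toℕ k) ⟨
      poly a b ⟦ + toℕ k ⟧   ≡⟨ hit (⟦toℕ⟧ k) ⟩
      ⟦ y ⟧                  ∎)
      where open ≡.≡-Reasoning

    -- A permutation of ℤ_N is onto modulo d, hence, by finiteness, one-to-one modulo d.
    injective-mod : ∀ {d} → d ∣ N → ∀ x y → + d ∣ᶻ f x ℤ.- f y → + d ∣ᶻ x ℤ.- y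
    injective-mod {d} d∣N x y d∣fx-fy = D.∣-difference (D.⟦⟧-injective {x} {y} (surjective⇒injective surjective (begin
      g D.⟦ x ⟧     ≡⟨ g⟦⟧ x ⟩
      D.⟦ f x ⟧     ≡⟨ D.⟦⟧-cong {f x} {f y} (D.congruent d∣fx-fy) ⟩
      D.⟦ f y ⟧     ≡⟨ g⟦⟧ y ⟨
      g D.⟦ y ⟧     ∎)))
      where
      open ≡.≡-Reasoning
      instance
        d≢0 : NonZero d
        d≢0 = ℕ.≢-nonZero λ { ≡.refl → ℕ.≢-nonZero⁻¹ N (0∣⇒≡0 d∣N) }
      module D = ResidueProperties d
      g : Fin d → Fin d
      g i = D.⟦ f (+ toℕ i) ⟧
      g⟦⟧ : ∀ x → g D.⟦ x ⟧ ≡ D.⟦ f x ⟧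
      g⟦⟧ x = D.⟦⟧-cong {f (+ toℕ D.⟦ x ⟧)} {f x}
        (quadratic-≋ (+ d) {+ α} {+ α} {+ β} {+ β} D.≋-refl D.≋-refl (D.toℕ⟦x⟧≋x x))
      surjective : StrictlySurjective _≡_ g
      surjective k = let x , fx≋k = surjective-mod (+ toℕ k) in D.⟦ x ⟧ , (begin
        g D.⟦ x ⟧         ≡⟨ g⟦⟧ x ⟩
        D.⟦ f x ⟧         ≡⟨ D.⟦⟧-cong {f x} {+ toℕ k} (D.congruent (∣ᶻ-trans (∣ᵤ⇒∣ d∣N) (∣-difference fx≋k))) ⟩
        D.⟦ + toℕ k ⟧     ≡⟨ D.⟦toℕ⟧ k ⟩
        k                 ∎)

-- Functions with trivial third multiplicative difference.

module ThirdDifference (R : RealNumbers c ℓ₁ ℓ₂ ℓ₃) where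
  open ComplexNumbers R
  open ComplexProperties R
  open CommutativeSemigroupProperties
    (CommutativeMonoid.commutativeSemigroup *-commutativeMonoid) using (interchange)
  open SetoidReasoning setoid

  -- The third multiplicative difference of g is 1, with inverses cleared.
  record Quadratic (g : ℤ → ℂ) : Set ℓ₁ where
    constructor mkQuadratic
    field
      third-difference : ∀ x h →
        let g₀ = g x ; g₁ = g (x ℤ.+ h) ; g₂ = g (x ℤ.+ h ℤ.+ h) ; g₃ = g (x ℤ.+ h ℤ.+ h ℤ.+ h) in
        g₃ * (g₁ * (g₁ * g₁)) ≈ g₀ * (g₂ * (g₂ * g₂))
  open Quadratic public

  private
    *-cube-cong : ∀ {z z′ w w′} → z ≈ z′ → w ≈ w′ → z * (w * (w * w)) ≈ z′ * (w′ * (w′ * w′))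
    *-cube-cong p q = *-cong p (*-cong q (*-cong q q))

    *-cube-distrib : ∀ z z′ w w′ →
      (z * z′) * ((w * w′) * ((w * w′) * (w * w′))) ≈ (z * (w * (w * w))) * (z′ * (w′ * (w′ * w′)))
    *-cube-distrib z z′ w w′ = begin
      (z * z′) * ((w * w′) * ((w * w′) * (w * w′)))        ≈⟨ *-congˡ {z * z′} (*-congˡ {w * w′} (interchange w w′ w w′)) ⟩
      (z * z′) * ((w * w′) * ((w * w) * (w′ * w′)))        ≈⟨ *-congˡ {z * z′} (interchange w w′ (w * w) (w′ * w′)) ⟩
      (z * z′) * ((w * (w * w)) * (w′ * (w′ * w′)))        ≈⟨ interchange z z′ (w * (w * w)) (w′ * (w′ * w′)) ⟩
      (z * (w * (w * w))) * (z′ * (w′ * (w′ * w′)))        ∎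

    conj-*-cube : ∀ z w → conj (z * (w * (w * w))) ≈ conj z * (conj w * (conj w * conj w))
    conj-*-cube z w = trans (conj-* z (w * (w * w))) (*-congˡ {conj z}
      (trans (conj-* w (w * w)) (*-congˡ {conj w} (conj-* w w))))

  quadratic-resp-≈ : ∀ {f g} → (∀ x → f x ≈ g x) → Quadratic g → Quadratic f
  quadratic-resp-≈ f≈g (mkQuadratic quad) = mkQuadratic λ x h → trans (*-cube-cong (f≈g _) (f≈g _))
    (trans (quad x h) (sym (*-cube-cong (f≈g _) (f≈g _))))

  quadratic-* : ∀ {f g} → Quadratic f → Quadratic g → Quadratic (λ x → f x * g x)
  quadratic-* {f} {g} (mkQuadratic quad-f) (mkQuadratic quad-g) = mkQuadratic λ x h → trans (*-cube-distrib (f _) (g _) (f _) (g _))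
    (trans (*-cong (quad-f x h) (quad-g x h)) (sym (*-cube-distrib (f _) (g _) (f _) (g _))))

  quadratic-conj : ∀ {g} → Quadratic g → Quadratic (conj ∘ g)
  quadratic-conj {g} (mkQuadratic quad) = mkQuadratic λ x h → trans (sym (conj-*-cube (g _) (g _)))
    (trans (conj-cong (quad x h)) (conj-*-cube (g _) (g _)))

  quadratic-constant : ∀ z → Quadratic (λ _ → z)
  quadratic-constant z = mkQuadratic λ x h → refl {z * (z * (z * z))}

  -- An affine map turns a progression of step h into one of step a h. Invariance under decimation
  -- is thus the reason for admitting every step.
  quadratic-affine : ∀ {g} a b → Quadratic g → Quadratic (λ x → g (a ℤ.* x ℤ.+ b))
  quadratic-affine {g} a b (mkQuadratic quad) = mkQuadratic λ x h → trans
    (*-cube-cong (reflexive (≡.cong g (step₃ a b x h))) (reflexive (≡.cong g (step₁ a b x h))))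
    (trans (quad (a ℤ.* x ℤ.+ b) (a ℤ.* h))
      (*-cube-cong refl (reflexive (≡.cong g (≡.sym (step₂ a b x h))))))
    where
    step₁ : ∀ a b x h → a ℤ.* (x ℤ.+ h) ℤ.+ b ≡ a ℤ.* x ℤ.+ b ℤ.+ a ℤ.* h
    step₁ = solve-∀
    step₂ : ∀ a b x h → a ℤ.* (x ℤ.+ h ℤ.+ h) ℤ.+ b ≡ a ℤ.* x ℤ.+ b ℤ.+ a ℤ.* h ℤ.+ a ℤ.* h
    step₂ = solve-∀
    step₃ : ∀ a b x h → a ℤ.* (x ℤ.+ h ℤ.+ h ℤ.+ h) ℤ.+ b ≡ a ℤ.* x ℤ.+ b ℤ.+ a ℤ.* h ℤ.+ a ℤ.* h ℤ.+ a ℤ.* h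
    step₃ = solve-∀

  module _ {z : ℂ} (∣z∣≈1 : Unimodular z) where
    open UnimodularPower ∣z∣≈1

    ^ᶻ-*-cube : ∀ i j → z ^ᶻ i * (z ^ᶻ j * (z ^ᶻ j * z ^ᶻ j)) ≈ z ^ᶻ (i ℤ.+ (j ℤ.+ (j ℤ.+ j)))
    ^ᶻ-*-cube i j = sym (trans (^ᶻ-homo-+ i (j ℤ.+ (j ℤ.+ j))) (*-congˡ {z ^ᶻ i}
      (trans (^ᶻ-homo-+ j (j ℤ.+ j)) (*-congˡ {z ^ᶻ j} (^ᶻ-homo-+ j j)))))

    quadratic-^ᶻ : ∀ {f : ℤ → ℤ} →
      (∀ x h → let f₁ = f (x ℤ.+ h) ; f₂ = f (x ℤ.+ h ℤ.+ h) in
        f (x ℤ.+ h ℤ.+ h ℤ.+ h) ℤ.+ (f₁ ℤ.+ (f₁ ℤ.+ f₁)) ≡ f x ℤ.+ (f₂ ℤ.+ (f₂ ℤ.+ f₂))) →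
      Quadratic (λ x → z ^ᶻ f x)
    quadratic-^ᶻ {f} Δ³f≡0 = mkQuadratic λ x h → trans (^ᶻ-*-cube (f _) (f _))
      (trans (reflexive (≡.cong (z ^ᶻ_) (Δ³f≡0 x h))) (sym (^ᶻ-*-cube (f _) (f _))))

-- Zadoff-Chu sequences, and invariance of quadratic phases under the five operations.

2∣n[n+1] : ∀ n → + 2 ∣ᶻ n ℤ.* (n ℤ.+ + 1)
2∣n[n+1] n = ∣-resp-≋ (≋-* n≋ (≋-+ n≋ (≋-refl {+ 1}))) (cases ⟦ n ⟧)
  where
  open ResidueProperties 2
  n≋ : + toℕ ⟦ n ⟧ ≋ n
  n≋ = toℕ⟦x⟧≋x n
  cases : ∀ (k : Fin 2) → + 2 ∣ᶻ + toℕ k ℤ.* (+ toℕ k ℤ.+ + 1)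
  cases Fin.zero           = divides (+ 0) ≡.refl
  cases (Fin.suc Fin.zero) = divides (+ 1) ≡.refl

-- This is n³ ≡ n modulo 3 in a form without subtraction: at the residues 0, 1, 2 the values are 0,
-- 3, 12.
3∣n³+2n : ∀ n → + 3 ∣ᶻ n ℤ.* (n ℤ.* n) ℤ.+ + 2 ℤ.* n
3∣n³+2n n = ∣-resp-≋ (≋-+ (≋-* n≋ (≋-* n≋ n≋)) (≋-* (≋-refl {+ 2}) n≋)) (cases ⟦ n ⟧)
  where
  open ResidueProperties 3
  n≋ : + toℕ ⟦ n ⟧ ≋ n
  n≋ = toℕ⟦x⟧≋x n
  cases : ∀ (k : Fin 3) → + 3 ∣ᶻ + toℕ k ℤ.* (+ toℕ k ℤ.* + toℕ k) ℤ.+ + 2 ℤ.* + toℕ k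
  cases Fin.zero                     = divides (+ 0) ≡.refl
  cases (Fin.suc Fin.zero)           = divides (+ 1) ≡.refl
  cases (Fin.suc (Fin.suc Fin.zero)) = divides (+ 4) ≡.refl

module SequenceProperties {R : RealNumbers c ℓ₁ ℓ₂ ℓ₃} (C : CircularFunctions R)
                          (N : ℕ) .{{_ : NonZero N}} where
  open ComplexNumbers R
  open ComplexProperties R
  open ThirdDifference R
  open RootOfUnity C N
  open UnimodularPower ζ-unimodular
  open Residues N
  open ResidueProperties N
  open Sequences C N
  private
    ε h : ℤ
    ε = + (N ℕ.% 2)
    h = + (N ℕ./ 2)

    N≡ε+h*2 : + N ≡ ε ℤ.+ h ℤ.* + 2
    N≡ε+h*2 = ≡.trans (≡.cong +_ (m≡m%n+[m/n]*n N 2))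
      (≡.trans (ℤ.pos-+ (N ℕ.% 2) (N ℕ./ 2 ℕ.* 2)) (≡.cong (λ k → ε ℤ.+ k) (ℤ.pos-* (N ℕ./ 2) 2)))

  on-residues : ∀ {p} {P : ℤ/N → Set p} → (∀ x → P ⟦ x ⟧) → ∀ k → P k
  on-residues {P = P} p k = ≡.subst P (⟦toℕ⟧ k) (p (+ toℕ k))

  zcExponent : (u q t : ℤ) → ℤ
  zcExponent u q t = u ℤ.* (t ℤ.+ ε ℤ.+ + 2 ℤ.* q) ℤ.* t

  -- Adding m N to t changes the exponent by u N (2 t m + m² N + ε m + 2 q m). Substituting N = ε +
  -- 2 h in the bracket leaves ε m (m + 1) plus an even number, so the bracket is even.
  zcExponent-periodic : ∀ u q {t t′} → t ≋ t′ → + (2 ℕ.* N) ∣ᶻ zcExponent u q t ℤ.- zcExponent u q t′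
  zcExponent-periodic u q {t} {t′} (congruent (divides m t-t′≡mN)) = lemma (2∣n[n+1] m)
    where
    shifted : ∀ u e q h t m →
      let t+mN = t ℤ.+ m ℤ.* (e ℤ.+ h ℤ.* + 2) in
      u ℤ.* (t+mN ℤ.+ e ℤ.+ + 2 ℤ.* q) ℤ.* t+mN ℤ.- u ℤ.* (t ℤ.+ e ℤ.+ + 2 ℤ.* q) ℤ.* t ≡
      u ℤ.* (+ 2 ℤ.* (t ℤ.* m ℤ.+ h ℤ.* (m ℤ.* m) ℤ.+ q ℤ.* m) ℤ.+ e ℤ.* (m ℤ.* (m ℤ.+ + 1))) ℤ.* (e ℤ.+ h ℤ.* + 2)
    shifted = solve-∀
    collect : ∀ u s e T n → u ℤ.* (+ 2 ℤ.* s ℤ.+ e ℤ.* (T ℤ.* + 2)) ℤ.* n ≡ u ℤ.* (s ℤ.+ e ℤ.* T) ℤ.* (+ 2 ℤ.* n)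
    collect = solve-∀
    add-difference : ∀ t t′ → t ≡ t′ ℤ.+ (t ℤ.- t′)
    add-difference = solve-∀
    s = t′ ℤ.* m ℤ.+ h ℤ.* (m ℤ.* m) ℤ.+ q ℤ.* m
    t≡t′+mN : t ≡ t′ ℤ.+ m ℤ.* (ε ℤ.+ h ℤ.* + 2)
    t≡t′+mN = ≡.trans (add-difference t t′)
      (≡.cong (λ k → t′ ℤ.+ k) (≡.trans t-t′≡mN (≡.cong (m ℤ.*_) N≡ε+h*2)))
    lemma : + 2 ∣ᶻ m ℤ.* (m ℤ.+ + 1) → + (2 ℕ.* N) ∣ᶻ zcExponent u q t ℤ.- zcExponent u q t′
    lemma (divides T m[m+1]≡T*2) = divides (u ℤ.* (s ℤ.+ ε ℤ.* T)) (begin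
      zcExponent u q t ℤ.- zcExponent u q t′
        ≡⟨ ≡.cong (λ t → zcExponent u q t ℤ.- zcExponent u q t′) t≡t′+mN ⟩
      zcExponent u q (t′ ℤ.+ m ℤ.* (ε ℤ.+ h ℤ.* + 2)) ℤ.- zcExponent u q t′
        ≡⟨ shifted u ε q h t′ m ⟩
      u ℤ.* (+ 2 ℤ.* s ℤ.+ ε ℤ.* (m ℤ.* (m ℤ.+ + 1))) ℤ.* (ε ℤ.+ h ℤ.* + 2)
        ≡⟨ ≡.cong₂ (λ k n → u ℤ.* (+ 2 ℤ.* s ℤ.+ ε ℤ.* k) ℤ.* n) m[m+1]≡T*2 (≡.sym N≡ε+h*2) ⟩
      u ℤ.* (+ 2 ℤ.* s ℤ.+ ε ℤ.* (T ℤ.* + 2)) ℤ.* + N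
        ≡⟨ collect u s ε T (+ N) ⟩
      u ℤ.* (s ℤ.+ ε ℤ.* T) ℤ.* (+ 2 ℤ.* + N)
        ≡⟨ ≡.cong (u ℤ.* (s ℤ.+ ε ℤ.* T) ℤ.*_) (ℤ.pos-* 2 N) ⟨
      u ℤ.* (s ℤ.+ ε ℤ.* T) ℤ.* + (2 ℕ.* N)    ∎)
      where open ≡.≡-Reasoning

  zadoffChu-⟦⟧ : ∀ u q x → zadoffChu u q ⟦ x ⟧ ≈ ζ ^ᶻ zcExponent u q x
  zadoffChu-⟦⟧ u q x = ζ^ᶻ-cong (zcExponent u q (+ toℕ ⟦ x ⟧)) (zcExponent u q x)
    (zcExponent-periodic u q (toℕ⟦x⟧≋x x))

  zadoffChu∘poly-⟦⟧ : ∀ u q a b x →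
    zadoffChu u q (poly a b ⟦ x ⟧) ≈ ζ ^ᶻ zcExponent u q (quadratic (+ toℕ a) (+ toℕ b) x)
  zadoffChu∘poly-⟦⟧ u q a b x = trans
    (reflexive (≡.cong (zadoffChu u q) (poly-⟦⟧ a b x)))
    (zadoffChu-⟦⟧ u q (quadratic (+ toℕ a) (+ toℕ b) x))

  W^-⟦⟧ : ∀ l x → W ^ (toℕ ⟦ l ⟧ ℕ.* toℕ ⟦ x ⟧) ≈ ζ ^ᶻ (+ 2 ℤ.* (l ℤ.* x))
  W^-⟦⟧ l x = trans (^-assocˡ ζ k 2)
    (ζ^ᶻ-cong (+ (k ℕ.* 2)) (+ 2 ℤ.* (l ℤ.* x)) (double (≋-* (toℕ⟦x⟧≋x l) (toℕ⟦x⟧≋x x))))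
    where
    k = toℕ ⟦ l ⟧ ℕ.* toℕ ⟦ x ⟧
    factor : ∀ i j y → i ℤ.* j ℤ.* + 2 ℤ.- + 2 ℤ.* y ≡ + 2 ℤ.* (i ℤ.* j ℤ.- y)
    factor = solve-∀
    regroup : ∀ m n → + 2 ℤ.* (m ℤ.* n) ≡ m ℤ.* (+ 2 ℤ.* n)
    regroup = solve-∀
    double : + toℕ ⟦ l ⟧ ℤ.* + toℕ ⟦ x ⟧ ≋ l ℤ.* x → + (2 ℕ.* N) ∣ᶻ + (k ℕ.* 2) ℤ.- + 2 ℤ.* (l ℤ.* x)
    double (congruent (divides m eq)) = divides m (begin
      + (k ℕ.* 2) ℤ.- + 2 ℤ.* (l ℤ.* x)
        ≡⟨ ≡.cong (λ i → i ℤ.- + 2 ℤ.* (l ℤ.* x)) (≡.trans (ℤ.pos-* k 2) (≡.cong (ℤ._* + 2) (ℤ.pos-* (toℕ ⟦ l ⟧) (toℕ ⟦ x ⟧)))) ⟩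
      + toℕ ⟦ l ⟧ ℤ.* + toℕ ⟦ x ⟧ ℤ.* + 2 ℤ.- + 2 ℤ.* (l ℤ.* x)
        ≡⟨ factor (+ toℕ ⟦ l ⟧) (+ toℕ ⟦ x ⟧) (l ℤ.* x) ⟩
      + 2 ℤ.* (+ toℕ ⟦ l ⟧ ℤ.* + toℕ ⟦ x ⟧ ℤ.- l ℤ.* x)
        ≡⟨ ≡.cong (+ 2 ℤ.*_) eq ⟩
      + 2 ℤ.* (m ℤ.* + N)
        ≡⟨ regroup m (+ N) ⟩
      m ℤ.* (+ 2 ℤ.* + N)
        ≡⟨ ≡.cong (m ℤ.*_) (ℤ.pos-* 2 N) ⟨
      m ℤ.* + (2 ℕ.* N)    ∎)
      where open ≡.≡-Reasoning

  -- Pulling the sequence back to ℤ makes progressions that wrap around modulo N ordinary integer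
  -- expressions.
  QuadraticPhase : Sequence → Set ℓ₁
  QuadraticPhase s = Quadratic (s ∘ ⟦_⟧)

  -- By periodicity the exponent may be taken as a polynomial of degree 2 on all of ℤ, not just at
  -- least residues, and its third differences vanish.
  zadoffChu-quadraticPhase : ∀ u q → QuadraticPhase (zadoffChu u q)
  zadoffChu-quadraticPhase u q = quadratic-resp-≈ (zadoffChu-⟦⟧ u q)
    (quadratic-^ᶻ ζ-unimodular {zcExponent u q} (Δ³≡0 u ε q))
    where
    Δ³≡0 : ∀ u e q x h →
      let f = λ t → u ℤ.* (t ℤ.+ e ℤ.+ + 2 ℤ.* q) ℤ.* t
          f₁ = f (x ℤ.+ h) ; f₂ = f (x ℤ.+ h ℤ.+ h) in
      f (x ℤ.+ h ℤ.+ h ℤ.+ h) ℤ.+ (f₁ ℤ.+ (f₁ ℤ.+ f₁)) ≡ f x ℤ.+ (f₂ ℤ.+ (f₂ ℤ.+ f₂))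
    Δ³≡0 = solve-∀

  private
    quadraticPhase-* : ∀ s t {m : ℤ → ℂ} → Quadratic m → (∀ x → t ⟦ x ⟧ ≈ m x * s ⟦ x ⟧) →
      QuadraticPhase s → QuadraticPhase t
    quadraticPhase-* s t {m} m-quad t≈ms s-quad = quadratic-resp-≈ {t ∘ ⟦_⟧} {λ x → m x * s ⟦ x ⟧} t≈ms (quadratic-* m-quad s-quad)

    quadraticPhase-affine : ∀ s t i j → (∀ x → t ⟦ x ⟧ ≈ s ⟦ i ℤ.* x ℤ.+ j ⟧) →
      QuadraticPhase s → QuadraticPhase t
    quadraticPhase-affine s t i j t≈s s-quad =
      quadratic-resp-≈ {t ∘ ⟦_⟧} {λ x → s ⟦ i ℤ.* x ℤ.+ j ⟧} t≈s (quadratic-affine {s ∘ ⟦_⟧} i j s-quad)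

    cancel-multiplier : ∀ {m m′ z w} → m′ * m ≈ 1ℂ → w ≈ m * z → z ≈ m′ * w
    cancel-multiplier {m} {m′} {z} {w} m′m≈1 w≈mz = begin
      z             ≈⟨ *-identityˡ z ⟨
      1ℂ * z        ≈⟨ *-congʳ m′m≈1 ⟨
      (m′ * m) * z  ≈⟨ *-assoc m′ m z ⟩
      m′ * (m * z)  ≈⟨ *-congˡ {m′} w≈mz ⟨
      m′ * w        ∎
      where open SetoidReasoning setoid

  linear-phase : ∀ l → Quadratic (λ x → ζ ^ᶻ (+ 2 ℤ.* (l ℤ.* x)))
  linear-phase l = quadratic-^ᶻ ζ-unimodular {λ x → + 2 ℤ.* (l ℤ.* x)} (Δ³≡0 l)
    where
    Δ³≡0 : ∀ l x h →
      let f = λ x → + 2 ℤ.* (l ℤ.* x)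
          f₁ = f (x ℤ.+ h) ; f₂ = f (x ℤ.+ h ℤ.+ h) in
      f (x ℤ.+ h ℤ.+ h ℤ.+ h) ℤ.+ (f₁ ℤ.+ (f₁ ℤ.+ f₁)) ≡ f x ℤ.+ (f₂ ℤ.+ (f₂ ℤ.+ f₂))
    Δ³≡0 = solve-∀

  -- `Equivalent` is a symmetric closure, so both directions are called for. Each operation is
  -- undone by one of its own kind: the conjugate constant, the shift by - d, the inverse unit, the
  -- modulation by - l, and conjugation itself.
  operation-quadraticPhase : ∀ {s t} → Operation s t → QuadraticPhase s ⇔ QuadraticPhase t
  operation-quadraticPhase {s} {t} (scale z ∣z∣≈1 t≈zs) = mk⇔
    (quadraticPhase-* s t (quadratic-constant z) (λ x → t≈zs ⟦ x ⟧))
    (quadraticPhase-* t s (quadratic-constant (conj z)) λ x →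
      cancel-multiplier (trans (*-comm (conj z) z) (unimodular⇒conj-inverse ∣z∣≈1)) (t≈zs ⟦ x ⟧))
  operation-quadraticPhase {s} {t} (shift d t≈s⊕d) = mk⇔
    (quadraticPhase-affine s t (+ 1) δ λ x → trans (t≈s⊕d ⟦ x ⟧)
      (reflexive (≡.cong s (≡.trans (⟦⟧⊕d x) (≡.cong ⟦_⟧ (forward x δ))))))
    (quadraticPhase-affine t s (+ 1) (ℤ.- δ) λ x → sym (trans (t≈s⊕d ⟦ + 1 ℤ.* x ℤ.+ ℤ.- δ ⟧)
      (reflexive (≡.cong s (≡.trans (⟦⟧⊕d (+ 1 ℤ.* x ℤ.+ ℤ.- δ)) (≡.cong ⟦_⟧ (backward x δ)))))))
    where
    δ = + toℕ d
    ⟦⟧⊕d : ∀ x → ⟦ x ⟧ ⊕ d ≡ ⟦ x ℤ.+ δ ⟧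
    ⟦⟧⊕d x = ≡.trans (≡.cong (⟦ x ⟧ ⊕_) (≡.sym (⟦toℕ⟧ d))) (⟦⟧-⊕ x δ)
    forward : ∀ x d → x ℤ.+ d ≡ + 1 ℤ.* x ℤ.+ d
    forward = solve-∀
    backward : ∀ x d → + 1 ℤ.* x ℤ.+ ℤ.- d ℤ.+ d ≡ x
    backward = solve-∀
  operation-quadraticPhase {s} {t} (decimate r (r′ , r⊗r′≡1) t≈s⊗r) = mk⇔
    (quadraticPhase-affine s t ρ (+ 0) λ x → trans (t≈s⊗r ⟦ x ⟧)
      (reflexive (≡.cong s (≡.trans (r⊗⟦⟧ x) (≡.cong ⟦_⟧ (≡.sym (ℤ.+-identityʳ (ρ ℤ.* x))))))))
    (quadraticPhase-affine t s ρ′ (+ 0) λ x → sym (trans (t≈s⊗r ⟦ ρ′ ℤ.* x ℤ.+ + 0 ⟧)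
      (reflexive (≡.cong s (≡.trans (r⊗⟦⟧ (ρ′ ℤ.* x ℤ.+ + 0)) (⟦⟧-cong (inverse x)))))))
    where
    ρ = + toℕ r
    ρ′ = + toℕ r′
    r⊗⟦⟧ : ∀ x → r ⊗ ⟦ x ⟧ ≡ ⟦ ρ ℤ.* x ⟧
    r⊗⟦⟧ x = ≡.trans (≡.cong (_⊗ ⟦ x ⟧) (≡.sym (⟦toℕ⟧ r))) (⟦⟧-⊗ ρ x)
    ρρ′≋1 : ρ ℤ.* ρ′ ≋ + 1
    ρρ′≋1 = ≋-trans (≋-reflexive (≡.sym (ℤ.pos-* (toℕ r) (toℕ r′)))) (⟦⟧-injective {+ (toℕ r ℕ.* toℕ r′)} {+ 1} r⊗r′≡1)
    regroup : ∀ r r′ x → r ℤ.* (r′ ℤ.* x ℤ.+ + 0) ≡ r ℤ.* r′ ℤ.* x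
    regroup = solve-∀
    inverse : ∀ x → ρ ℤ.* (ρ′ ℤ.* x ℤ.+ + 0) ≋ x
    inverse x = ≋-trans (≋-reflexive (regroup ρ ρ′ x))
      (≋-trans (≋-* ρρ′≋1 (≋-refl {x})) (≋-reflexive (ℤ.*-identityˡ x)))
  operation-quadraticPhase {s} {t} (modulate l t≈Ws) = mk⇔
    (quadraticPhase-* s t (linear-phase (+ toℕ l)) t≈ζs)
    (quadraticPhase-* t s (linear-phase (ℤ.- + toℕ l)) λ x → cancel-multiplier
      (trans (sym (^ᶻ-homo-+ (+ 2 ℤ.* (ℤ.- + toℕ l ℤ.* x)) (+ 2 ℤ.* (+ toℕ l ℤ.* x))))
        (reflexive (≡.cong (ζ ^ᶻ_) (cancel (+ toℕ l) x))))
      (t≈ζs x))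
    where
    t≈ζs : ∀ x → t ⟦ x ⟧ ≈ ζ ^ᶻ (+ 2 ℤ.* (+ toℕ l ℤ.* x)) * s ⟦ x ⟧
    t≈ζs x = trans (t≈Ws ⟦ x ⟧) (*-congʳ (trans
      (reflexive (≡.cong (λ l → W ^ (toℕ l ℕ.* toℕ ⟦ x ⟧)) (≡.sym (⟦toℕ⟧ l))))
      (W^-⟦⟧ (+ toℕ l) x)))
    cancel : ∀ l x → + 2 ℤ.* (ℤ.- l ℤ.* x) ℤ.+ + 2 ℤ.* (l ℤ.* x) ≡ + 0
    cancel = solve-∀
  operation-quadraticPhase {s} {t} (conjugate t≈s̄) = mk⇔
    (λ quad → quadratic-resp-≈ {t ∘ ⟦_⟧} {conj ∘ s ∘ ⟦_⟧} (λ x → t≈s̄ ⟦ x ⟧) (quadratic-conj {s ∘ ⟦_⟧} quad))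
    (λ quad → quadratic-resp-≈ {s ∘ ⟦_⟧} {conj ∘ t ∘ ⟦_⟧} (λ x → trans (conj-involutive (s ⟦ x ⟧)) (conj-cong (sym (t≈s̄ ⟦ x ⟧))))
      (quadratic-conj {t ∘ ⟦_⟧} quad))
    where
    open RealProperties R using (-‿involutive)
    module ℝ = RealNumbers R
    conj-involutive : ∀ z → z ≈ conj (conj z)
    conj-involutive z = ℝ.refl , ℝ.sym (-‿involutive (im z))

  equivalent-quadraticPhase : ∀ {s t} → Equivalent s t → QuadraticPhase s ⇔ QuadraticPhase t
  equivalent-quadraticPhase = EqClosure.gfold ⇔-isEquivalence QuadraticPhase operation-quadraticPhase

-- Divisibility constraints on the coefficients and on N.

prime[3] : Prime 3
prime[3] = from-yes (prime? 3)

2∤3 : 2 ∤ 3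
2∤3 = from-no (2 ∣? 3)

prime-divisor : ∀ {n} → 1 ℕ.< n → ∃[ p ] (Prime p × p ∣ n)
prime-divisor {n@(suc _)} 1<n with factorise n
... | record { factors = [] ; isFactorisation = n≡1 } = contradiction (≡.sym n≡1) (ℕ.<⇒≢ 1<n)
... | record { factors = p ∷ ps ; isFactorisation = n≡p*ps ; factorsPrime = p-prime ∷ _ } =
  p , p-prime , ≡.subst (p ∣_) (≡.sym n≡p*ps) (m∣m*n _)

prime∤⇒coprime : ∀ {p n} → Prime p → p ∤ n → Coprime p n
prime∤⇒coprime p-prime p∤n (d∣p , d∣n) with prime⇒irreducible p-prime d∣p
... | inj₁ d≡1 = d≡1
... | inj₂ ≡.refl = contradiction d∣n p∤n

prime∤1 : ∀ {p} → Prime p → p ∤ 1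
prime∤1 p-prime p∣1 = ℕ.nonTrivial⇒≢1 {{prime⇒nonTrivial p-prime}} (∣1⇒≡1 p∣1)

odd-prime∤2 : ∀ {p} → Prime p → 2 ∤ p → p ∤ 2
odd-prime∤2 p-prime 2∤p p∣2 with prime⇒irreducible prime[2] p∣2
... | inj₁ ≡.refl = prime∤1 p-prime ∣-refl
... | inj₂ ≡.refl = 2∤p ∣-refl

-- Bézout over ℕ comes in two sign patterns; when 1 + y n = x m, the inverse of n is - y.
inverse-mod : ∀ {m n} → Coprime m n → ∃[ c ] + m ∣ᶻ + n ℤ.* c ℤ.- + 1
inverse-mod {m} {n} coprime with Coprime.coprime-Bézout coprime
... | Bézout.+- x y eq = ℤ.- + y , divides (ℤ.- + x) (lift x y m n eq)
  where
  lemma : ∀ y n → n ℤ.* ℤ.- y ℤ.- + 1 ≡ ℤ.- (+ 1 ℤ.+ y ℤ.* n)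
  lemma = solve-∀
  lift : ∀ x y m n → 1 ℕ.+ y ℕ.* n ≡ x ℕ.* m → + n ℤ.* ℤ.- + y ℤ.- + 1 ≡ ℤ.- + x ℤ.* + m
  lift x y m n eq = begin
    + n ℤ.* ℤ.- + y ℤ.- + 1          ≡⟨ lemma (+ y) (+ n) ⟩
    ℤ.- (+ 1 ℤ.+ + y ℤ.* + n)        ≡⟨ ≡.cong (λ k → ℤ.- (+ 1 ℤ.+ k)) (ℤ.pos-* y n) ⟨
    ℤ.- + (1 ℕ.+ y ℕ.* n)            ≡⟨ ≡.cong (ℤ.-_ ∘ +_) eq ⟩
    ℤ.- + (x ℕ.* m)                  ≡⟨ ≡.cong ℤ.-_ (ℤ.pos-* x m) ⟩
    ℤ.- (+ x ℤ.* + m)                ≡⟨ ℤ.neg-distribˡ-* (+ x) (+ m) ⟩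
    ℤ.- + x ℤ.* + m                  ∎
    where open ≡.≡-Reasoning
... | Bézout.-+ x y eq = + y , divides (+ x) (lift x y m n eq)
  where
  lemma : ∀ k → + 1 ℤ.+ k ℤ.- + 1 ≡ k
  lemma = solve-∀
  lift : ∀ x y m n → 1 ℕ.+ x ℕ.* m ≡ y ℕ.* n → + n ℤ.* + y ℤ.- + 1 ≡ + x ℤ.* + m
  lift x y m n eq = begin
    + n ℤ.* + y ℤ.- + 1              ≡⟨ ≡.cong (ℤ._- + 1) (ℤ.pos-* n y) ⟨
    + (n ℕ.* y) ℤ.- + 1              ≡⟨ ≡.cong (λ k → + k ℤ.- + 1) (≡.trans (ℕ.*-comm n y) (≡.sym eq)) ⟩
    + 1 ℤ.+ + (x ℕ.* m) ℤ.- + 1      ≡⟨ lemma (+ (x ℕ.* m)) ⟩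
    + (x ℕ.* m)                      ≡⟨ ℤ.pos-* x m ⟩
    + x ℤ.* + m                      ∎
    where open ≡.≡-Reasoning

module _ (N : ℕ) .{{_ : NonZero N}} where
  open Residues N
  open ResidueProperties N using (⟦_⟧)

  module PermutationCoefficients (a b : ℤ/N) (bijective : Bijective _≡_ _≡_ (poly a b)) where
    open Permutation N a b bijective
    private
      α = toℕ a
      β = toℕ b

    -- α + β is f 1 - f 0, so a common divisor d with N would identify 1 with 0 modulo d.
    a+b-coprime : Coprime N (α ℕ.+ β)
    a+b-coprime {d} (d∣N , d∣α+β) = ∣1⇒≡1 (∣⇒∣ᵤ (injective-mod d∣N (+ 1) (+ 0)
      (≡.subst (+ d ∣ᶻ_) (≡.trans (ℤ.pos-+ α β) (lemma (+ α) (+ β))) (∣ᵤ⇒∣ d∣α+β))))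
      where
      lemma : ∀ a b → a ℤ.+ b ≡ a ℤ.* (+ 1 ℤ.* + 1) ℤ.+ b ℤ.* + 1 ℤ.- (a ℤ.* (+ 0 ℤ.* + 0) ℤ.+ b ℤ.* + 0)
      lemma = solve-∀

    -- If a were invertible modulo p, then for s = - b / a both f s ≡ f 0 and
    -- f (s - 1) ≡ f 1, so that s ≡ 0 and s ≡ 2.
    odd-prime-∣a : ∀ {p} → Prime p → 2 ∤ p → p ∣ N → p ∣ α
    odd-prime-∣a {p} p-prime 2∤p p∣N with p ∣? α
    ... | yes p∣α = p∣α
    ... | no p∤α with c , p∣αc-1 ← inverse-mod (prime∤⇒coprime p-prime p∤α) =
      contradiction (∣⇒∣ᵤ (≡.subst (+ p ∣ᶻ_) (two s) (∣m∣n⇒∣m-n p∣s p∣s-2))) (odd-prime∤2 p-prime 2∤p)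
      where
      s = ℤ.- (+ β ℤ.* c)
      root : ∀ a b c → ℤ.- b ℤ.* (a ℤ.* c ℤ.- + 1) ≡ a ℤ.* ℤ.- (b ℤ.* c) ℤ.+ b
      root = solve-∀
      p∣αs+β : + p ∣ᶻ + α ℤ.* s ℤ.+ + β
      p∣αs+β = ≡.subst (+ p ∣ᶻ_) (root (+ α) (+ β) c) (∣n⇒∣m*n (ℤ.- + β) p∣αc-1)
      difference : ∀ a b s t → (s ℤ.- t ℤ.- t) ℤ.* (a ℤ.* s ℤ.+ b) ≡
        a ℤ.* ((s ℤ.- t) ℤ.* (s ℤ.- t)) ℤ.+ b ℤ.* (s ℤ.- t) ℤ.- (a ℤ.* (t ℤ.* t) ℤ.+ b ℤ.* t)
      difference = solve-∀
      p∣s-2t : ∀ t → + p ∣ᶻ s ℤ.- t ℤ.- t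
      p∣s-2t t = injective-mod p∣N (s ℤ.- t) t
        (≡.subst (+ p ∣ᶻ_) (difference (+ α) (+ β) s t) (∣n⇒∣m*n (s ℤ.- t ℤ.- t) p∣αs+β))
      p∣s = p∣s-2t (+ 0)
      p∣s-2 = p∣s-2t (+ 1)
      two : ∀ s → s ℤ.- + 0 ℤ.- + 0 ℤ.- (s ℤ.- + 1 ℤ.- + 1) ≡ + 2
      two = solve-∀

    -- As N is even, a + b is odd. An odd a would therefore make b even, and f 2 - f 0 = 4 a + 2 b
    -- would vanish modulo 4, identifying 2 with 0.
    4∣N⇒2∣a : 4 ∣ N → 2 ∣ α
    4∣N⇒2∣a 4∣N with 2 ∣? α
    ... | yes 2∣α = 2∣α
    ... | no 2∤α = contradiction (∣⇒∣ᵤ (injective-mod 4∣N (+ 2) (+ 0) 4∣f2-f0)) (from-no (4 ∣? 2))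
      where
      parity : ∀ m → 2 ∣ m ⊎ 2 ∣ suc m
      parity zero = inj₁ (dividesℕ 0 ≡.refl)
      parity (suc m) with parity m
      ... | inj₁ 2∣m = inj₂ (∣ℕm∣n⇒∣m+n (∣-refl {2}) 2∣m)
      ... | inj₂ 2∣1+m = inj₁ 2∣1+m
      2∣β : 2 ∣ β
      2∣β with parity α | parity β
      ... | inj₁ 2∣α   | _         = contradiction 2∣α 2∤α
      ... | inj₂ _     | inj₁ 2∣β  = 2∣β
      ... | inj₂ 2∣1+α | inj₂ 2∣1+β = contradiction
        (a+b-coprime
          ( ∣-trans (dividesℕ 2 ≡.refl) 4∣N
          , ∣m+n∣m⇒∣n {2} {2} {α ℕ.+ β} (≡.subst (2 ∣_) (≡.cong suc (ℕ.+-suc α β)) (∣ℕm∣n⇒∣m+n 2∣1+α 2∣1+β)) ∣-refl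
          ))
        λ ()
      identity : ∀ a b → a ℤ.* + 4 ℤ.+ + 2 ℤ.* b ≡ a ℤ.* (+ 2 ℤ.* + 2) ℤ.+ b ℤ.* + 2 ℤ.- (a ℤ.* (+ 0 ℤ.* + 0) ℤ.+ b ℤ.* + 0)
      identity = solve-∀
      4∣f2-f0 : + 4 ∣ᶻ quadratic (+ α) (+ β) (+ 2) ℤ.- quadratic (+ α) (+ β) (+ 0)
      4∣f2-f0 = ≡.subst (+ 4 ∣ᶻ_) (identity (+ α) (+ β))
        (∣m∣n⇒∣m+n (divides (+ α) ≡.refl) (≡.subst (+ 4 ∣ᶻ_) (ℤ.pos-* 2 β) (∣ᵤ⇒∣ (*-monoʳ-∣ 2 2∣β))))

    -- If 3 ∤ N, the factor 3 cancels. Otherwise N = 3 m with 3 ∤ m because 9 ∤ N, and 2 a = 3 t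
    -- because 3 ∣ a. Then m ∣ 3 t, hence m ∣ t and 3 m ∣ 3 t.
    N∣6a⇒N∣2a : 9 ∤ N → N ∣ 3 ℕ.* (2 ℕ.* α) → N ∣ 2 ℕ.* α
    N∣6a⇒N∣2a 9∤N N∣6α with 3 ∣? N
    ... | no 3∤N = coprime-divisor {N} {3} (Coprime.sym (prime∤⇒coprime prime[3] 3∤N)) N∣6α
    ... | yes (dividesℕ m N≡m*3) with dividesℕ t 2α≡t*3 ← ∣ℕn⇒∣m*n 2 (odd-prime-∣a prime[3] 2∤3 (dividesℕ m N≡m*3)) =
      ≡.subst₂ _∣_ (≡.sym N≡m*3) (≡.sym 2α≡t*3) (*-monoˡ-∣ 3 (coprime-divisor {m} {3} {t} m-coprime-3 m∣3t))
      where
      m-coprime-3 : Coprime m 3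
      m-coprime-3 = Coprime.sym (prime∤⇒coprime prime[3] λ 3∣m → 9∤N (≡.subst (9 ∣_) (≡.sym N≡m*3) (*-monoˡ-∣ 3 3∣m)))
      m∣3t : m ∣ 3 ℕ.* t
      m∣3t = *-cancelʳ-∣ 3 (≡.subst₂ _∣_ N≡m*3 (≡.trans (≡.cong (3 ℕ.*_) 2α≡t*3) (≡.sym (ℕ.*-assoc 3 t 3))) N∣6α)

    -- A prime p dividing N / g satisfies p g ∣ N. If p is odd, it divides a, hence g, and p² ∣ N.
    -- For p = 2 the argument climbs in stages: 2 ∣ g gives 4 ∣ N, so 2 ∣ a, so 4 ∣ g, and finally 8
    -- ∣ N.
    prime-square-or-8 : ℕ.gcd N (2 ℕ.* α) ℕ.< N → 8 ∣ N ⊎ ∃[ p ] (Prime p × 2 ∤ p × p ℕ.^ 2 ∣ N)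
    prime-square-or-8 g<N = case-prime (prime-divisor (quotient>1 g∣N g<N))
      where
      g = ℕ.gcd N (2 ℕ.* α)
      g∣N : g ∣ N
      g∣N = ℕ.gcd[m,n]∣m N (2 ℕ.* α)
      m = _∣_.quotient g∣N
      p*g∣N : ∀ {p} → p ∣ m → p ℕ.* g ∣ N
      p*g∣N {p} p∣m = ≡.subst (p ℕ.* g ∣_) (≡.sym (m∣n⇒n≡quotient*m g∣N)) (*-monoˡ-∣ g p∣m)
      case-prime : ∃[ p ] (Prime p × p ∣ m) → 8 ∣ N ⊎ ∃[ p ] (Prime p × 2 ∤ p × p ℕ.^ 2 ∣ N)
      case-prime (p , p-prime , p∣m) with 2 ∣? p
      ... | no 2∤p = inj₂ (p , p-prime , 2∤p , ≡.subst (λ k → p ℕ.* k ∣ N) (≡.sym (ℕ.*-identityʳ p))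
          (∣-trans (*-monoʳ-∣ p p∣g) (p*g∣N p∣m)))
        where
        p∣N = ∣-trans (m∣m*n g) (p*g∣N p∣m)
        p∣g = ℕ.gcd-greatest p∣N (∣ℕn⇒∣m*n 2 {α} (odd-prime-∣a p-prime 2∤p p∣N))
      ... | yes 2∣p with prime⇒irreducible p-prime 2∣p
      ...   | inj₂ ≡.refl = inj₁ (∣-trans (*-monoʳ-∣ 2 4∣g) (p*g∣N p∣m))
        where
        2∣N = ∣-trans (m∣m*n g) (p*g∣N p∣m)
        2∣g = ℕ.gcd-greatest 2∣N (m∣m*n {2} α)
        4∣N = ∣-trans (*-monoʳ-∣ 2 2∣g) (p*g∣N p∣m)
        4∣g = ℕ.gcd-greatest {N} {2 ℕ.* α} 4∣N (*-monoʳ-∣ 2 (4∣N⇒2∣a 4∣N))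

  𝒬-irr-inhabited : 8 ∣ N ⊎ ∃[ p ] (Prime p × 2 ∤ p × p ℕ.^ 2 ∣ N) → ∃[ a ] ∃[ b ] 𝒬-irr a b
  𝒬-irr-inhabited (inj₁ (dividesℕ m N≡m*8)) =
    ⟦ + (m ℕ.* 2) ⟧ , ⟦ + 1 ⟧ , nilpotent⇒𝒬-irr N {m ℕ.* 2} {4} (≡.trans N≡m*8 (≡.sym (ℕ.*-assoc m 2 4)))
      (*-pres-∣ (n∣m*n m) (n∣m*n m)) (>⇒∤ (ℕ.s≤s (ℕ.s≤s (ℕ.s≤s ℕ.z≤n))))
  𝒬-irr-inhabited (inj₂ (p , p-prime , 2∤p , dividesℕ m N≡m*p²)) =
    ⟦ + (m ℕ.* p) ⟧ , ⟦ + 1 ⟧ , nilpotent⇒𝒬-irr N {m ℕ.* p} {p}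
      (≡.trans N≡m*p² (≡.trans (≡.cong (λ k → m ℕ.* (p ℕ.* k)) (ℕ.*-identityʳ p)) (≡.sym (ℕ.*-assoc m p p))))
      (∣ℕn⇒∣m*n (m ℕ.* p) (n∣m*n m)) (odd-prime∤2 p-prime 2∤p)

-- Zadoff-Chu sequences composed with permutation polynomials.

module Permutations {R : RealNumbers c ℓ₁ ℓ₂ ℓ₃} (C : CircularFunctions R)
                    (N : ℕ) .{{_ : NonZero N}} where
  open ComplexNumbers R using (_≈_; _*_; _^ᶻ_; 1ℂ) renaming (_^_ to _^ᶜ_)
  open ComplexProperties R
  open ThirdDifference R using (^ᶻ-*-cube; third-difference)
  open RootOfUnity C N
  open UnimodularPower ζ-unimodular
  open Residues N
  open ResidueProperties N
  open Sequences C N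
  open SequenceProperties C N

  ζ^ᶻi≈ζ^ᶻj⇒ζ^ᶻ[i-j]≈1 : ∀ i j → ζ ^ᶻ i ≈ ζ ^ᶻ j → ζ ^ᶻ (i ℤ.- j) ≈ 1ℂ
  ζ^ᶻi≈ζ^ᶻj⇒ζ^ᶻ[i-j]≈1 i j ζⁱ≈ζʲ = begin
    ζ ^ᶻ (i ℤ.- j)             ≈⟨ ^ᶻ-homo-+ i (ℤ.- j) ⟩
    ζ ^ᶻ i * ζ ^ᶻ (ℤ.- j)      ≈⟨ *-congʳ ζⁱ≈ζʲ ⟩
    ζ ^ᶻ j * ζ ^ᶻ (ℤ.- j)      ≈⟨ *-comm (ζ ^ᶻ j) (ζ ^ᶻ (ℤ.- j)) ⟩
    ζ ^ᶻ (ℤ.- j) * ζ ^ᶻ j      ≈⟨ ^ᶻ-inverse j ⟩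
    1ℂ                         ∎
    where open SetoidReasoning setoid

  -- The third difference of the phase u (π² + c π) at - 1 is 12 u a (a + b),
  -- because that of π = a X² + b X itself vanishes.
  quadraticPhase⇒N∣6ua[a+b] : ∀ u q (a b : ℤ/N) → QuadraticPhase (zadoffChu u q ∘ poly a b) →
    + N ∣ᶻ u ℤ.* ((+ toℕ a ℤ.+ + toℕ b) ℤ.* (+ 3 ℤ.* (+ 2 ℤ.* + toℕ a)))
  quadraticPhase⇒N∣6ua[a+b] u q a b quad = ζ^ᶻ2i≈1⇒N∣i {i = Δ} (trans
    (reflexive (≡.cong (ζ ^ᶻ_) (≡.sym (identity u (+ (N ℕ.% 2)) q α β))))
    (ζ^ᶻi≈ζ^ᶻj⇒ζ^ᶻ[i-j]≈1 (cubed (+ 2) (+ 0)) (cubed (ℤ.- + 1) (+ 1)) (begin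
      ζ ^ᶻ cubed (+ 2) (+ 0)                      ≈⟨ ^ᶻ-*-cube ζ-unimodular (E (+ 2)) (E (+ 0)) ⟨
      ζ ^ᶻ E (+ 2) * (ζ ^ᶻ E (+ 0) * (ζ ^ᶻ E (+ 0) * ζ ^ᶻ E (+ 0)))
        ≈⟨ *-cong (s≈ (+ 2)) (*-cong (s≈ (+ 0)) (*-cong (s≈ (+ 0)) (s≈ (+ 0)))) ⟨
      s (+ 2) * (s (+ 0) * (s (+ 0) * s (+ 0)))   ≈⟨ third-difference quad (ℤ.- + 1) (+ 1) ⟩
      s (ℤ.- + 1) * (s (+ 1) * (s (+ 1) * s (+ 1)))
        ≈⟨ *-cong (s≈ (ℤ.- + 1)) (*-cong (s≈ (+ 1)) (*-cong (s≈ (+ 1)) (s≈ (+ 1)))) ⟩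
      ζ ^ᶻ E (ℤ.- + 1) * (ζ ^ᶻ E (+ 1) * (ζ ^ᶻ E (+ 1) * ζ ^ᶻ E (+ 1)))
        ≈⟨ ^ᶻ-*-cube ζ-unimodular (E (ℤ.- + 1)) (E (+ 1)) ⟩
      ζ ^ᶻ cubed (ℤ.- + 1) (+ 1)                  ∎)))
    where
    open SetoidReasoning setoid
    α = + toℕ a
    β = + toℕ b
    Δ = u ℤ.* ((α ℤ.+ β) ℤ.* (+ 3 ℤ.* (+ 2 ℤ.* α)))
    E : ℤ → ℤ
    E x = zcExponent u q (quadratic α β x)
    cubed : ℤ → ℤ → ℤ
    cubed x y = E x ℤ.+ (E y ℤ.+ (E y ℤ.+ E y))
    s = zadoffChu u q ∘ poly a b ∘ ⟦_⟧
    s≈ : ∀ x → s x ≈ ζ ^ᶻ E x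
    s≈ = zadoffChu∘poly-⟦⟧ u q a b
    identity : ∀ u e q a b →
      let f = λ x → a ℤ.* (x ℤ.* x) ℤ.+ b ℤ.* x
          E = λ x → u ℤ.* (f x ℤ.+ e ℤ.+ + 2 ℤ.* q) ℤ.* f x in
      (E (+ 2) ℤ.+ (E (+ 0) ℤ.+ (E (+ 0) ℤ.+ E (+ 0)))) ℤ.- (E (ℤ.- + 1) ℤ.+ (E (+ 1) ℤ.+ (E (+ 1) ℤ.+ E (+ 1))))
        ≡ + 2 ℤ.* (u ℤ.* ((a ℤ.+ b) ℤ.* (+ 3 ℤ.* (+ 2 ℤ.* a))))
    identity = solve-∀

  inequivalent : 9 ∤ N → ∀ a b → 𝒬-irr a b → ∀ u → gcd u (+ N) ≡ + 1 → ∀ q →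
    ¬ EquivalentToZadoffChu (zadoffChu u q ∘ poly a b)
  inequivalent 9∤N a b ((bijective , _) , gcd<N) u gcd≡1 q (u′ , q′ , _ , equivalent) =
    ℕ.<⇒≢ gcd<N (∣-antisym (ℕ.gcd[m,n]∣m N (2 ℕ.* toℕ a)) (ℕ.gcd-greatest ∣-refl N∣2α))
    where
    open PermutationCoefficients N a b bijective
    α = toℕ a
    β = toℕ b
    N∣ : + N ∣ᶻ u ℤ.* ((+ α ℤ.+ + β) ℤ.* (+ 3 ℤ.* (+ 2 ℤ.* + α)))
    N∣ = quadraticPhase⇒N∣6ua[a+b] u q a b
      (Equivalence.from (equivalent-quadraticPhase equivalent) (zadoffChu-quadraticPhase u′ q′))
    N∣2α : N ∣ 2 ℕ.* α
    -- The factors u, a + b and 3 are removed in this order, the first two as units modulo N.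
    N∣2α = N∣6a⇒N∣2a 9∤N (coprime-divisor {N} {α ℕ.+ β} a+b-coprime
      (coprime-divisor {N} {ℤ.∣ u ∣} (Coprime.sym (gcd≡1⇒coprime (ℤ.+-injective gcd≡1)))
        (≡.subst (N ∣_) (≡.trans (ℤ.abs-* u _) (≡.cong (ℤ.∣ u ∣ ℕ.*_) abs≡)) (∣⇒∣ᵤ N∣))))
      where
      abs≡ : ℤ.∣ (+ α ℤ.+ + β) ℤ.* (+ 3 ℤ.* (+ 2 ℤ.* + α)) ∣ ≡ (α ℕ.+ β) ℕ.* (3 ℕ.* (2 ℕ.* α))
      abs≡ = ≡.trans (ℤ.abs-* (+ α ℤ.+ + β) (+ 3 ℤ.* (+ 2 ℤ.* + α)))
        (≡.cong ((α ℕ.+ β) ℕ.*_) (≡.trans (ℤ.abs-* (+ 3) (+ 2 ℤ.* + α)) (≡.cong (3 ℕ.*_) (ℤ.abs-* (+ 2) (+ α)))))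

  -- For N = 9 m and π = 3 m X² + X, the phase t (t + N) of the Zadoff–Chu sequence
  -- with u = 1 and ε + 2 q = N satisfies
  --   π (π + N) - x (x + N) - 6 m x = 9 m² (x⁴ + 3 x²) + 6 m (x³ - x) ≡ 0 mod 2 N.
  module _ (m : ℕ) (N≡m*9 : N ≡ m ℕ.* 9) where
    private
      κ = + (m ℕ.* 3)
      η = + (N ℕ./ 2)

    zcExponent∘quadratic : ∀ x →
      + (2 ℕ.* N) ∣ᶻ zcExponent (+ 1) η (quadratic κ (+ 1) x) ℤ.- (+ 2 ℤ.* (κ ℤ.* x) ℤ.+ zcExponent (+ 1) η x)
    zcExponent∘quadratic x = lemma (2∣n[n+1] (x ℤ.* x)) (3∣n³+2n x)
      where
      open ≡.≡-Reasoning
      μ = + m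
      ε+2η≡9μ : + (N ℕ.% 2) ℤ.+ + 2 ℤ.* η ≡ μ ℤ.* + 9
      ε+2η≡9μ = begin
        + (N ℕ.% 2) ℤ.+ + 2 ℤ.* η                ≡⟨ ≡.cong (λ k → + (N ℕ.% 2) ℤ.+ k) (ℤ.pos-* 2 (N ℕ./ 2)) ⟨
        + (N ℕ.% 2 ℕ.+ 2 ℕ.* (N ℕ./ 2))            ≡⟨ ≡.cong (λ k → + (N ℕ.% 2 ℕ.+ k)) (ℕ.*-comm 2 (N ℕ./ 2)) ⟩
        + (N ℕ.% 2 ℕ.+ N ℕ./ 2 ℕ.* 2)              ≡⟨ ≡.cong +_ (m≡m%n+[m/n]*n N 2) ⟨
        + N                                    ≡⟨ ≡.cong +_ N≡m*9 ⟩
        + (m ℕ.* 9)                            ≡⟨ ℤ.pos-* m 9 ⟩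
        μ ℤ.* + 9                              ∎
      phase : ℤ → ℤ
      phase t = (t ℤ.+ μ ℤ.* + 9) ℤ.* t
      zcExponent≡phase : ∀ t → zcExponent (+ 1) η t ≡ phase t
      zcExponent≡phase t = ≡.trans (regroup t (+ (N ℕ.% 2)) (+ 2 ℤ.* η)) (≡.cong (λ k → (t ℤ.+ k) ℤ.* t) ε+2η≡9μ)
        where
        regroup : ∀ t e q → + 1 ℤ.* (t ℤ.+ e ℤ.+ q) ℤ.* t ≡ (t ℤ.+ (e ℤ.+ q)) ℤ.* t
        regroup = solve-∀
      -- x⁴ + 3 x² is grouped as x² (x² + 1) + 2 x², and x³ - x as (x³ + 2 x) - 3 x. The known
      -- divisibilities by 2 and 3 then turn both summands into multiples of 2 N = 18 m.
      expand : ∀ m x →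
        let t = m ℤ.* + 3 ℤ.* (x ℤ.* x) ℤ.+ + 1 ℤ.* x in
        (t ℤ.+ m ℤ.* + 9) ℤ.* t ℤ.- (+ 2 ℤ.* (m ℤ.* + 3 ℤ.* x) ℤ.+ (x ℤ.+ m ℤ.* + 9) ℤ.* x) ≡
        + 9 ℤ.* m ℤ.* m ℤ.* (x ℤ.* x ℤ.* (x ℤ.* x ℤ.+ + 1) ℤ.+ + 2 ℤ.* (x ℤ.* x))
          ℤ.+ + 6 ℤ.* m ℤ.* (x ℤ.* (x ℤ.* x) ℤ.+ + 2 ℤ.* x ℤ.- + 3 ℤ.* x)
      expand = solve-∀
      collect : ∀ m x y T S →
        + 9 ℤ.* m ℤ.* m ℤ.* (T ℤ.* + 2 ℤ.+ + 2 ℤ.* y) ℤ.+ + 6 ℤ.* m ℤ.* (S ℤ.* + 3 ℤ.- + 3 ℤ.* x) ≡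
        (m ℤ.* (T ℤ.+ y) ℤ.+ S ℤ.- x) ℤ.* (+ 2 ℤ.* (m ℤ.* + 9))
      collect = solve-∀
      2N≡2[9μ] : + (2 ℕ.* N) ≡ + 2 ℤ.* (μ ℤ.* + 9)
      2N≡2[9μ] = ≡.trans (ℤ.pos-* 2 N) (≡.cong (+ 2 ℤ.*_) (≡.trans (≡.cong +_ N≡m*9) (ℤ.pos-* m 9)))
      lemma : + 2 ∣ᶻ x ℤ.* x ℤ.* (x ℤ.* x ℤ.+ + 1) → + 3 ∣ᶻ x ℤ.* (x ℤ.* x) ℤ.+ + 2 ℤ.* x → _
      lemma (divides T T-eq) (divides S S-eq) = divides (μ ℤ.* (T ℤ.+ x ℤ.* x) ℤ.+ S ℤ.- x) (begin
        zcExponent (+ 1) η (quadratic κ (+ 1) x) ℤ.- (+ 2 ℤ.* (κ ℤ.* x) ℤ.+ zcExponent (+ 1) η x)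
          ≡⟨ ≡.cong₂ (λ i j → i ℤ.- (+ 2 ℤ.* (κ ℤ.* x) ℤ.+ j)) (zcExponent≡phase (quadratic κ (+ 1) x)) (zcExponent≡phase x) ⟩
        phase (quadratic κ (+ 1) x) ℤ.- (+ 2 ℤ.* (κ ℤ.* x) ℤ.+ phase x)
          ≡⟨ ≡.cong (λ k → phase (quadratic k (+ 1) x) ℤ.- (+ 2 ℤ.* (k ℤ.* x) ℤ.+ phase x)) (ℤ.pos-* m 3) ⟩
        phase (quadratic (μ ℤ.* + 3) (+ 1) x) ℤ.- (+ 2 ℤ.* (μ ℤ.* + 3 ℤ.* x) ℤ.+ phase x)
          ≡⟨ expand μ x ⟩
        + 9 ℤ.* μ ℤ.* μ ℤ.* (x ℤ.* x ℤ.* (x ℤ.* x ℤ.+ + 1) ℤ.+ + 2 ℤ.* (x ℤ.* x))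
          ℤ.+ + 6 ℤ.* μ ℤ.* (x ℤ.* (x ℤ.* x) ℤ.+ + 2 ℤ.* x ℤ.- + 3 ℤ.* x)
          ≡⟨ ≡.cong₂ (λ i j → + 9 ℤ.* μ ℤ.* μ ℤ.* (i ℤ.+ + 2 ℤ.* (x ℤ.* x)) ℤ.+ + 6 ℤ.* μ ℤ.* (j ℤ.- + 3 ℤ.* x)) T-eq S-eq ⟩
        + 9 ℤ.* μ ℤ.* μ ℤ.* (T ℤ.* + 2 ℤ.+ + 2 ℤ.* (x ℤ.* x)) ℤ.+ + 6 ℤ.* μ ℤ.* (S ℤ.* + 3 ℤ.- + 3 ℤ.* x)
          ≡⟨ collect μ x (x ℤ.* x) T S ⟩
        (μ ℤ.* (T ℤ.+ x ℤ.* x) ℤ.+ S ℤ.- x) ℤ.* (+ 2 ℤ.* (μ ℤ.* + 9))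
          ≡⟨ ≡.cong ((μ ℤ.* (T ℤ.+ x ℤ.* x) ℤ.+ S ℤ.- x) ℤ.*_) 2N≡2[9μ] ⟨
        (μ ℤ.* (T ℤ.+ x ℤ.* x) ℤ.+ S ℤ.- x) ℤ.* + (2 ℕ.* N)    ∎)

    zadoffChu∘poly≈modulated : ∀ x → zadoffChu (+ 1) η (poly ⟦ κ ⟧ ⟦ + 1 ⟧ ⟦ x ⟧) ≈
      (W ^ᶜ (toℕ ⟦ κ ⟧ ℕ.* toℕ ⟦ x ⟧)) * zadoffChu (+ 1) η ⟦ x ⟧
    zadoffChu∘poly≈modulated x = begin
      zadoffChu (+ 1) η (poly ⟦ κ ⟧ ⟦ + 1 ⟧ ⟦ x ⟧)
        ≡⟨ ≡.cong (zadoffChu (+ 1) η) (⟦⟧-poly κ (+ 1) x) ⟩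
      zadoffChu (+ 1) η ⟦ quadratic κ (+ 1) x ⟧
        ≈⟨ zadoffChu-⟦⟧ (+ 1) η (quadratic κ (+ 1) x) ⟩
      ζ ^ᶻ zcExponent (+ 1) η (quadratic κ (+ 1) x)
        ≈⟨ ζ^ᶻ-cong (zcExponent (+ 1) η (quadratic κ (+ 1) x)) (+ 2 ℤ.* (κ ℤ.* x) ℤ.+ zcExponent (+ 1) η x) (zcExponent∘quadratic x) ⟩
      ζ ^ᶻ (+ 2 ℤ.* (κ ℤ.* x) ℤ.+ zcExponent (+ 1) η x)
        ≈⟨ ^ᶻ-homo-+ (+ 2 ℤ.* (κ ℤ.* x)) (zcExponent (+ 1) η x) ⟩
      ζ ^ᶻ (+ 2 ℤ.* (κ ℤ.* x)) * ζ ^ᶻ zcExponent (+ 1) η x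
        ≈⟨ *-cong (W^-⟦⟧ κ x) (zadoffChu-⟦⟧ (+ 1) η x) ⟨
      (W ^ᶜ (toℕ ⟦ κ ⟧ ℕ.* toℕ ⟦ x ⟧)) * zadoffChu (+ 1) η ⟦ x ⟧  ∎
      where open SetoidReasoning setoid

    9∣N⇒equivalent : EquivalentToZadoffChu (zadoffChu (+ 1) η ∘ poly ⟦ κ ⟧ ⟦ + 1 ⟧)
    9∣N⇒equivalent = + 1 , η , gcd-zeroˡ (+ N) ,
      -- The modulation leads from z to z ∘ π, so it is traversed backwards.
      Star.return (bwd (modulate ⟦ κ ⟧ (on-residues zadoffChu∘poly≈modulated)))

open import Data.Nat.Base using (_≤_; _^_)

corollary2 : ∀ {c ℓ₁ ℓ₂ ℓ₃} (R : RealNumbers c ℓ₁ ℓ₂ ℓ₃) (C : CircularFunctions R)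
    (N : ℕ) .{{_ : NonZero N}} → 2 ≤ N →
    let open Residues N
        open Sequences C N
    in
    ( (∃[ a ] ∃[ b ] 𝒬-irr a b)
    × (∀ a b → 𝒬-irr a b → ∀ (u : ℤ) → gcd u (+ N) ≡ + 1 → ∀ (q : ℤ) →
         ¬ EquivalentToZadoffChu (zadoffChu u q ∘ poly a b)) )
    ⇔
    ( 9 ∤ N × (8 ∣ N ⊎ ∃[ p ] (Prime p × 2 ∤ p × p ^ 2 ∣ N)) )
corollary2 R C N _ = mk⇔
  -- The given pair yields the condition on 8 or an odd prime square. The case 9 ∣ N is refuted by
  -- another member of `𝒬-irr`, namely (N / 3) X² + X.
  (λ ((a , b , irr) , none) →
    (λ (dividesℕ m N≡m*9) → none ⟦ + (m ℕ.* 3) ⟧ ⟦ + 1 ⟧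
      (nilpotent⇒𝒬-irr N {m ℕ.* 3} {3} (≡.trans N≡m*9 (≡.sym (ℕ.*-assoc m 3 3)))
        (∣-trans (n∣m*n m) (m∣m*n (m ℕ.* 3))) (from-no (3 ∣? 2)))
      (+ 1) (gcd-zeroˡ (+ N)) (+ (N ℕ./ 2)) (9∣N⇒equivalent m N≡m*9))
    , PermutationCoefficients.prime-square-or-8 N a b (proj₁ (proj₁ irr)) (proj₂ irr))
  (λ (9∤N , large) → 𝒬-irr-inhabited N large , inequivalent 9∤N)
  where
  open ResidueProperties N using (⟦_⟧)
  open Permutations C N
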